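{- Let $n,a,k\ge 1$ be integers and let $\vec p=(p_1,\dots,p_a)$ be a probability vector. The expected number of inversions of a permutation distributed according to the $k$-fold convolution of the biased $a$-shuffle measure $P_{n,a;\vec p}$ on $S_n$ is $$\frac{\binom n2}{2}\left[1-(p_1^2+\cdots+p_a^2)^k\right].$$
   Context: Probability vector: real $p_i\ge 0$ with $\sum_{i=1}^a p_i=1$. The number of inversions of $\pi$ is the number of pairs $i<j$ with $\pi(i)>\pi(j)$. Descents: $\pi\in S_n$ has a descent at position $i$ ($1\le i\le n-1$) if $\pi(i)>\pi(i+1)$; by convention every $\pi\in S_n$ also has a descent at position $n$. The descent set of $\pi$ is the set of positions at which it has a descent. The measure $P_{n,a;\vec p}$ on $S_n$ (biased riffle shuffle): first choose $(b_1,\dots,b_a)$, $b_i\ge 0$, $b_1+\cdots+b_a=n$, with probability $\binom{n}{b_1\cdots b_a}\prod_{i=1}^a p_i^{b_i}$; then choose uniformly one of the $\binom{n}{b_1\cdots b_a}$ permutations $\pi\in S_n$ such that the descent set of $\pi^{ -1}$ is contained in $\{b_1,b_1+b_2,\dots,b_1+\cdots+b_a=n\}$. The $k$-fold convolution of a measure $P$ on $S_n$ is the law of a product of $k$ independent permutations each with law $P$. -}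

module Defs where

open import Algebra.Bundles using (CommutativeRing; Semiring)
open import Algebra.Structures using (IsCommutativeRing)
open import Data.Bool using (if_then_else_)
open import Data.Fin as Fin using (Fin; toℕ)
import Data.Fin.Properties as Fin
open import Data.Fin.Permutation as Perm using (Permutation; _⟨$⟩ʳ_; insert; _∘ₚ_)
import Data.Integer as ℤ
open import Data.List as List using (List; []; _∷_; concatMap; cartesianProduct; allFin; upTo)
import Data.List.Relation.Unary.All.Properties as All
import Data.List.Relation.Unary.All as All
open import Data.Nat as ℕ using (ℕ; zero; suc; _!; _⊓_; _⊔_; NonZero)
open import Data.Nat.ListAction as ℕ using ()
open import Data.Nat.ListAction.Properties as ℕ using ()
import Data.Nat.Properties as ℕ
open import Data.Product using (∃; _×_; _,_; proj₁; proj₂; uncurry)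
open import Data.Rational as ℚ using (ℚ; 0ℚ; 1ℚ)
import Data.Rational.Properties as ℚ
open import Data.Rational.Solver using (module +-*-Solver)
open import Data.Sum using (_⊎_)
open import Data.Vec as Vec using (Vec; lookup; toList)
open import Data.Vec.Functional using (Vector)
open import Function using (id; _∘_)
open import Level using (0ℓ)
open import Relation.Binary.PropositionalEquality
open import Relation.Nullary using (Dec; does; _×-dec_; _⊎-dec_; _→-dec_)
open import Relation.Unary using (Pred; Decidable)

-- The real numbers ℝ below are Cauchy sequences of rationals with pointwise
-- operations; equality is the setoid relation _≈_.

-- A family z : I → ℚ tends to 0 as the stage s i ∈ ℕ of its index grows.
-- Single sequences use s = id, double sequences s (m , n) = m ⊓ n.
record Vanishing {I : Set} (s : I → ℕ) (z : I → ℚ) : Set where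
  constructor vanishing
  field
    eventually-< : ∀ {ε} → 0ℚ ℚ.< ε → ∃ λ N → ∀ i → N ℕ.≤ s i → ℚ.∣ z i ∣ ℚ.< ε

open Vanishing public

record EventuallyBounded {I : Set} (s : I → ℕ) (z : I → ℚ) : Set where
  constructor eventuallyBounded
  field
    bound   : ℚ
    0<bound : 0ℚ ℚ.< bound
    stage   : ℕ
    bounded : ∀ i → stage ℕ.≤ s i → ℚ.∣ z i ∣ ℚ.≤ bound

Cauchy : (ℕ → ℚ) → Set
Cauchy x = Vanishing (uncurry _⊓_) (λ (m , n) → x m ℚ.- x n)

abstract
  vanishing-0 : {I : Set} {s : I → ℕ} {z : I → ℚ} → (∀ i → z i ≡ 0ℚ) → Vanishing s z
  vanishing-0 z≡0 = vanishing λ 0<ε →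
    0 , λ i _ → subst (λ q → ℚ.∣ q ∣ ℚ.< _) (sym (z≡0 i)) 0<ε

  quotient : ∀ {B ε} → 0ℚ ℚ.< B → 0ℚ ℚ.< ε → ∃ λ δ → 0ℚ ℚ.< δ × B ℚ.* δ ≡ ε
  quotient {B} {ε} 0<B 0<ε = 1/B ℚ.* ε , 0<ε/B , (begin
    B ℚ.* (1/B ℚ.* ε)   ≡⟨ ℚ.*-assoc B 1/B ε ⟨
    (B ℚ.* 1/B) ℚ.* ε   ≡⟨ cong (ℚ._* ε) (ℚ.*-inverseʳ B) ⟩
    1ℚ ℚ.* ε            ≡⟨ ℚ.*-identityˡ ε ⟩
    ε                   ∎)
    where
    open ≡-Reasoning
    instance
      B-positive : ℚ.Positive B
      B-positive = ℚ.positive 0<B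
      B-nonZero : ℚ.NonZero B
      B-nonZero = ℚ.pos⇒nonZero B
    1/B : ℚ
    1/B = ℚ.1/ B
    instance
      1/B-positive : ℚ.Positive 1/B
      1/B-positive = ℚ.1/pos⇒pos B
    0<ε/B : 0ℚ ℚ.< 1/B ℚ.* ε
    0<ε/B = subst (ℚ._< 1/B ℚ.* ε) (ℚ.*-zeroʳ 1/B) (ℚ.*-monoʳ-<-pos 1/B 0<ε)

  vanishing-+ : {I : Set} {s : I → ℕ} {z w : I → ℚ} →
                Vanishing s z → Vanishing s w → Vanishing s (λ i → z i ℚ.+ w i)
  vanishing-+ {z = z} {w} vz vw = vanishing λ {ε} 0<ε →
    let (δ , 0<δ , 2δ≡ε) = quotient (ℚ.positive⁻¹ (1ℚ ℚ.+ 1ℚ)) 0<ε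
        (M , small-z) = eventually-< vz 0<δ
        (N , small-w) = eventually-< vw 0<δ
    in M ⊔ N , λ i M⊔N≤ → begin-strict
      ℚ.∣ z i ℚ.+ w i ∣         ≤⟨ ℚ.∣p+q∣≤∣p∣+∣q∣ (z i) (w i) ⟩
      ℚ.∣ z i ∣ ℚ.+ ℚ.∣ w i ∣   <⟨ ℚ.+-mono-< (small-z i (ℕ.m⊔n≤o⇒m≤o M N M⊔N≤))
                                              (small-w i (ℕ.m⊔n≤o⇒n≤o M N M⊔N≤)) ⟩
      δ ℚ.+ δ                   ≡⟨ cong₂ ℚ._+_ (ℚ.*-identityˡ δ) (ℚ.*-identityˡ δ) ⟨
      1ℚ ℚ.* δ ℚ.+ 1ℚ ℚ.* δ     ≡⟨ ℚ.*-distribʳ-+ δ 1ℚ 1ℚ ⟨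
      (1ℚ ℚ.+ 1ℚ) ℚ.* δ         ≡⟨ 2δ≡ε ⟩
      ε                         ∎
    where open ℚ.≤-Reasoning

  vanishing-neg : {I : Set} {s : I → ℕ} {z : I → ℚ} →
                  Vanishing s z → Vanishing s (λ i → ℚ.- z i)
  vanishing-neg {z = z} vz = vanishing λ 0<ε →
    let (N , small-z) = eventually-< vz 0<ε
    in N , λ i N≤ → subst (ℚ._< _) (sym (ℚ.∣-p∣≡∣p∣ (z i))) (small-z i N≤)

  vanishing-* : {I : Set} {s : I → ℕ} {b z : I → ℚ} →
                EventuallyBounded s b → Vanishing s z → Vanishing s (λ i → b i ℚ.* z i)
  vanishing-* {b = b} {z} (eventuallyBounded B 0<B M bounded) vz = vanishing λ {ε} 0<ε →
    let (δ , 0<δ , Bδ≡ε) = quotient 0<B 0<ε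
        (N , small-z) = eventually-< vz 0<δ
    in M ⊔ N , λ i M⊔N≤ → begin-strict
      ℚ.∣ b i ℚ.* z i ∣         ≡⟨ ℚ.∣p*q∣≡∣p∣*∣q∣ (b i) (z i) ⟩
      ℚ.∣ b i ∣ ℚ.* ℚ.∣ z i ∣   ≤⟨ ℚ.*-monoʳ-≤-nonNeg ℚ.∣ z i ∣ {{ℚ.∣-∣-nonNeg (z i)}}
                                     (bounded i (ℕ.m⊔n≤o⇒m≤o M N M⊔N≤)) ⟩
      B ℚ.* ℚ.∣ z i ∣           <⟨ ℚ.*-monoʳ-<-pos B {{ℚ.positive 0<B}}
                                     (small-z i (ℕ.m⊔n≤o⇒n≤o M N M⊔N≤)) ⟩
      B ℚ.* δ                   ≡⟨ Bδ≡ε ⟩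
      ε                         ∎
    where open ℚ.≤-Reasoning

  vanishing-cong : {I : Set} {s : I → ℕ} {z w : I → ℚ} →
                   (∀ i → z i ≡ w i) → Vanishing s z → Vanishing s w
  vanishing-cong z≡w vz = vanishing λ 0<ε →
    let (N , small-z) = eventually-< vz 0<ε
    in N , λ i N≤ → subst (λ q → ℚ.∣ q ∣ ℚ.< _) (z≡w i) (small-z i N≤)

  eventuallyBounded-reindex : {I J : Set} {s : I → ℕ} {t : J → ℕ} (f : J → I) {z : I → ℚ} →
                              (∀ j → t j ℕ.≤ s (f j)) →
                              EventuallyBounded s z → EventuallyBounded t (z ∘ f)
  eventuallyBounded-reindex f t≤s (eventuallyBounded B 0<B N bounded) =
    eventuallyBounded B 0<B N λ j N≤ → bounded (f j) (ℕ.≤-trans N≤ (t≤s j))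

  cauchy⇒bounded : ∀ x → Cauchy x → EventuallyBounded id x
  cauchy⇒bounded x cx with (N , close) ← eventually-< cx (ℚ.positive⁻¹ 1ℚ) =
    eventuallyBounded (1ℚ ℚ.+ ℚ.∣ x N ∣) (ℚ.+-mono-<-≤ (ℚ.positive⁻¹ 1ℚ) (ℚ.0≤∣p∣ (x N))) N λ n N≤n → begin
      ℚ.∣ x n ∣                             ≡⟨ cong ℚ.∣_∣ (split (x n) (x N)) ⟩
      ℚ.∣ (x n ℚ.- x N) ℚ.+ x N ∣           ≤⟨ ℚ.∣p+q∣≤∣p∣+∣q∣ (x n ℚ.- x N) (x N) ⟩
      ℚ.∣ x n ℚ.- x N ∣ ℚ.+ ℚ.∣ x N ∣       ≤⟨ ℚ.+-monoˡ-≤ ℚ.∣ x N ∣ (ℚ.<⇒≤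
                                                 (close (n , N) (ℕ.⊓-glb N≤n ℕ.≤-refl))) ⟩
      1ℚ ℚ.+ ℚ.∣ x N ∣                      ∎
    where
    open ℚ.≤-Reasoning
    split : ∀ p q → p ≡ (p ℚ.- q) ℚ.+ q
    split = solve 2 (λ p q → p := (p :- q) :+ q) refl
      where open +-*-Solver

  difference-+ : ∀ p q r s → (p ℚ.- q) ℚ.+ (r ℚ.- s) ≡ (p ℚ.+ r) ℚ.- (q ℚ.+ s)
  difference-+ = solve 4 (λ p q r s → (p :- q) :+ (r :- s) := (p :+ r) :- (q :+ s)) refl
    where open +-*-Solver

  difference-neg : ∀ p q → ℚ.- (p ℚ.- q) ≡ (ℚ.- p) ℚ.- (ℚ.- q)
  difference-neg = solve 2 (λ p q → :- (p :- q) := (:- p) :- (:- q)) refl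
    where open +-*-Solver

  difference-* : ∀ p q r s → p ℚ.* (r ℚ.- s) ℚ.+ s ℚ.* (p ℚ.- q) ≡ (p ℚ.* r) ℚ.- (q ℚ.* s)
  difference-* = solve 4 (λ p q r s → p :* (r :- s) :+ s :* (p :- q) := (p :* r) :- (q :* s)) refl
    where open +-*-Solver

  cauchy-const : ∀ q → Cauchy (λ _ → q)
  cauchy-const q = vanishing-0 (λ _ → ℚ.+-inverseʳ q)

  cauchy-+ : ∀ x y → Cauchy x → Cauchy y → Cauchy (λ n → x n ℚ.+ y n)
  cauchy-+ x y cx cy =
    vanishing-cong (λ (m , n) → difference-+ (x m) (x n) (y m) (y n)) (vanishing-+ cx cy)

  cauchy-neg : ∀ x → Cauchy x → Cauchy (λ n → ℚ.- x n)
  cauchy-neg x cx =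
    vanishing-cong (λ (m , n) → difference-neg (x m) (x n)) (vanishing-neg cx)

  cauchy-* : ∀ x y → Cauchy x → Cauchy y → Cauchy (λ n → x n ℚ.* y n)
  cauchy-* x y cx cy =
    vanishing-cong (λ (m , n) → difference-* (x m) (x n) (y m) (y n))
      (vanishing-+
        (vanishing-* (eventuallyBounded-reindex proj₁ (uncurry ℕ.m⊓n≤m) (cauchy⇒bounded x cx)) cy)
        (vanishing-* (eventuallyBounded-reindex proj₂ (uncurry ℕ.m⊓n≤n) (cauchy⇒bounded y cy)) cx))

record ℝ : Set where
  constructor mkℝ
  field
    seq    : ℕ → ℚ
    cauchy : Cauchy seq

open ℝ public

infix  4 _≈_ _≤_
infixl 6 _+_ _-_
infixl 7 _*_
infix  8 -_

record _≈_ (x y : ℝ) : Set where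
  constructor mk≈
  field
    difference-vanishes : Vanishing id (λ n → seq x n ℚ.- seq y n)

open _≈_ public

_≤_ : ℝ → ℝ → Set
x ≤ y = ∀ {ε} → 0ℚ ℚ.< ε → ∃ λ N → ∀ n → N ℕ.≤ n → seq x n ℚ.≤ seq y n ℚ.+ ε

fromℚ : ℚ → ℝ
fromℚ q = mkℝ (λ _ → q) (cauchy-const q)

fromℕ : ℕ → ℝ
fromℕ m = fromℚ (ℤ.+ m ℚ./ 1)

0ℝ 1ℝ : ℝ
0ℝ = fromℚ 0ℚ
1ℝ = fromℚ 1ℚ

_+_ _*_ : ℝ → ℝ → ℝ
x + y = mkℝ (λ n → seq x n ℚ.+ seq y n) (cauchy-+ (seq x) (seq y) (cauchy x) (cauchy y))
x * y = mkℝ (λ n → seq x n ℚ.* seq y n) (cauchy-* (seq x) (seq y) (cauchy x) (cauchy y))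

-_ : ℝ → ℝ
- x = mkℝ (λ n → ℚ.- seq x n) (cauchy-neg (seq x) (cauchy x))

_-_ : ℝ → ℝ → ℝ
x - y = x + (- y)

abstract
  pointwise⇒≈ : ∀ {x y} → (∀ n → seq x n ≡ seq y n) → x ≈ y
  pointwise⇒≈ {x} {y} eq = mk≈
    (vanishing-0 (λ n → trans (cong (ℚ._- seq y n) (eq n)) (ℚ.+-inverseʳ (seq y n))))

  ≈-sym : ∀ {x y} → x ≈ y → y ≈ x
  ≈-sym {x} {y} (mk≈ x-y) = mk≈
    (vanishing-cong (λ n → flip-difference (seq x n) (seq y n)) (vanishing-neg x-y))
    where
    flip-difference : ∀ p q → ℚ.- (p ℚ.- q) ≡ q ℚ.- p
    flip-difference = solve 2 (λ p q → :- (p :- q) := q :- p) refl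
      where open +-*-Solver

  ≈-trans : ∀ {x y z} → x ≈ y → y ≈ z → x ≈ z
  ≈-trans {x} {y} {z} (mk≈ x-y) (mk≈ y-z) = mk≈
    (vanishing-cong (λ n → telescope (seq x n) (seq y n) (seq z n)) (vanishing-+ x-y y-z))
    where
    telescope : ∀ p q r → (p ℚ.- q) ℚ.+ (q ℚ.- r) ≡ p ℚ.- r
    telescope = solve 3 (λ p q r → (p :- q) :+ (q :- r) := p :- r) refl
      where open +-*-Solver

  +-cong : ∀ {x y u v} → x ≈ y → u ≈ v → x + u ≈ y + v
  +-cong {x} {y} {u} {v} (mk≈ x-y) (mk≈ u-v) = mk≈
    (vanishing-cong (λ n → difference-+ (seq x n) (seq y n) (seq u n) (seq v n))
      (vanishing-+ x-y u-v))

  -‿cong : ∀ {x y} → x ≈ y → - x ≈ - y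
  -‿cong {x} {y} (mk≈ x-y) = mk≈
    (vanishing-cong (λ n → difference-neg (seq x n) (seq y n)) (vanishing-neg x-y))

  *-cong : ∀ {x y u v} → x ≈ y → u ≈ v → x * u ≈ y * v
  *-cong {x} {y} {u} {v} (mk≈ x-y) (mk≈ u-v) = mk≈
    (vanishing-cong (λ n → difference-* (seq x n) (seq y n) (seq u n) (seq v n))
      (vanishing-+ (vanishing-* (cauchy⇒bounded (seq x) (cauchy x)) u-v)
                   (vanishing-* (cauchy⇒bounded (seq v) (cauchy v)) x-y)))

isCommutativeRing : IsCommutativeRing _≈_ _+_ _*_ -_ 0ℝ 1ℝ
isCommutativeRing = record
  { isRing = record
    { +-isAbelianGroup = record
      { isGroup = record
        { isMonoid = record
          { isSemigroup = record
            { isMagma = record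
              { isEquivalence = record
                { refl  = pointwise⇒≈ (λ _ → refl)
                ; sym   = ≈-sym
                ; trans = ≈-trans
                }
              ; ∙-cong = +-cong
              }
            ; assoc = λ x y z → pointwise⇒≈ (λ n → ℚ.+-assoc (seq x n) (seq y n) (seq z n))
            }
          ; identity = (λ x → pointwise⇒≈ (λ n → ℚ.+-identityˡ (seq x n)))
                     , (λ x → pointwise⇒≈ (λ n → ℚ.+-identityʳ (seq x n)))
          }
        ; inverse = (λ x → pointwise⇒≈ (λ n → ℚ.+-inverseˡ (seq x n)))
                  , (λ x → pointwise⇒≈ (λ n → ℚ.+-inverseʳ (seq x n)))
        ; ⁻¹-cong = -‿cong
        }
      ; comm = λ x y → pointwise⇒≈ (λ n → ℚ.+-comm (seq x n) (seq y n))
      }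
    ; *-cong = *-cong
    ; *-assoc = λ x y z → pointwise⇒≈ (λ n → ℚ.*-assoc (seq x n) (seq y n) (seq z n))
    ; *-identity = (λ x → pointwise⇒≈ (λ n → ℚ.*-identityˡ (seq x n)))
                 , (λ x → pointwise⇒≈ (λ n → ℚ.*-identityʳ (seq x n)))
    ; distrib = (λ x y z → pointwise⇒≈ (λ n → ℚ.*-distribˡ-+ (seq x n) (seq y n) (seq z n)))
              , (λ x y z → pointwise⇒≈ (λ n → ℚ.*-distribʳ-+ (seq x n) (seq y n) (seq z n)))
    }
  ; *-comm = λ x y → pointwise⇒≈ (λ n → ℚ.*-comm (seq x n) (seq y n))
  }

commutativeRing : CommutativeRing 0ℓ 0ℓ
commutativeRing = record { isCommutativeRing = isCommutativeRing }

open import Algebra.Definitions.RawSemiring (Semiring.rawSemiring (CommutativeRing.semiring commutativeRing)) public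
  using (sum; product; _^_)

∑ : {A : Set} → List A → (A → ℝ) → ℝ
∑ xs f = List.foldr _+_ 0ℝ (List.map f xs)

indicator : {P : Set} → Dec P → ℝ
indicator P? = if does P? then 1ℝ else 0ℝ

-- 1/m, with the junk value 1/0 = 0.
reciprocal : ℕ → ℝ
reciprocal zero    = 0ℝ
reciprocal (suc m) = fromℚ (ℤ.+ 1 ℚ./ suc m)

IsProbabilityVector : ∀ {a} → Vector ℝ a → Set
IsProbabilityVector p = (∀ i → 0ℝ ≤ p i) × sum p ≈ 1ℝ

tuples : {A : Set} → List A → ∀ k → List (Vec A k)
tuples xs zero    = Vec.[] ∷ []
tuples xs (suc k) = concatMap (λ x → List.map (x Vec.∷_) (tuples xs k)) xs

-- Each element of Sₙ occurs exactly once up to Perm._≈_: a permutation of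
-- Fin (suc n) is determined by the image j of zero and by the permutation
-- of Fin n that remains once zero and j are deleted.
permutations : ∀ n → List (Permutation n n)
permutations zero    = Perm.id ∷ []
permutations (suc n) = concatMap (λ j → List.map (insert Fin.zero j) (permutations n)) (allFin (suc n))

inversions : ∀ {n} → Permutation n n → ℕ
inversions {n} π = List.length (List.filter inversion? (cartesianProduct (allFin n) (allFin n)))
  where
  inversion? : Decidable (λ ((i , j) : Fin n × Fin n) → i Fin.< j × (π ⟨$⟩ʳ j) Fin.< (π ⟨$⟩ʳ i))
  inversion? (i , j) = (i Fin.<? j) ×-dec ((π ⟨$⟩ʳ j) Fin.<? (π ⟨$⟩ʳ i))

-- i : Fin n stands for the position toℕ i + 1 ∈ {1, …, n}.
position : ∀ {n} → Fin n → ℕ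
position i = suc (toℕ i)

Descent : ∀ {n} → Permutation n n → Pred (Fin n) 0ℓ
Descent {n} π i =
  position i ≡ n ⊎
  (∃ λ (j : Fin n) → toℕ j ≡ suc (toℕ i) × (π ⟨$⟩ʳ j) Fin.< (π ⟨$⟩ʳ i))

descent? : ∀ {n} (π : Permutation n n) → Decidable (Descent π)
descent? {n} π i =
  (position i ℕ.≟ n) ⊎-dec
  Fin.any? (λ j → (toℕ j ℕ.≟ suc (toℕ i)) ×-dec ((π ⟨$⟩ʳ j) Fin.<? (π ⟨$⟩ʳ i)))

_≟ₚ_ : ∀ {n} (π σ : Permutation n n) → Dec (π Perm.≈ σ)
π ≟ₚ σ = Fin.all? (λ i → (π ⟨$⟩ʳ i) Fin.≟ (σ ⟨$⟩ʳ i))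

-- (π · σ)(i) = π(σ(i)); the library's _∘ₚ_ composes in the opposite order.
_·_ : ∀ {n} → Permutation n n → Permutation n n → Permutation n n
π · σ = σ ∘ₚ π

-- A measure on Sₙ, given by its mass function.
Measure : ℕ → Set
Measure n = Permutation n n → ℝ

expectation : ∀ {n} → Measure n → (Permutation n n → ℕ) → ℝ
expectation {n} P X = ∑ (permutations n) (λ π → P π * fromℕ (X π))

-- The uniform probability measure on S (which must be nonempty).
uniform : ∀ {n} {S : Pred (Permutation n n) 0ℓ} → Decidable S → Measure n
uniform {n} S? π = indicator (S? π) * reciprocal (List.length (List.filter S? (permutations n)))

-- The law of the product σ₁ · ⋯ · σₖ of independent σᵢ with law P.
convolutionPower : ∀ {n} → ℕ → Measure n → Measure n
convolutionPower {n} k P π =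
  ∑ (tuples (permutations n) k) λ σs →
    indicator (π ≟ₚ Vec.foldr _ _·_ Perm.id σs) * product (λ i → P (lookup σs i))

multinomial : ∀ {a} → Vec ℕ a → ℕ
multinomial b = (Vec.sum b !) ℕ./ ℕ.product (List.map _! (toList b))
  where
  instance
    ∏b!≢0 : NonZero (ℕ.product (List.map _! (toList b)))
    ∏b!≢0 = ℕ.product≢0 (All.map⁺ (All.universal ℕ._!≢0 (toList b)))

weakCompositions : (n a : ℕ) → List (Vec ℕ a)
weakCompositions n a = List.filter (λ b → Vec.sum b ℕ.≟ n) (tuples (upTo (suc n)) a)

-- b₁ + ⋯ + bᵢ, where i is a position in {1, …, a}.
partialSum : ∀ {a} → Vec ℕ a → Fin a → ℕ
partialSum b i = ℕ.sum (List.take (position i) (toList b))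

InverseDescentsWithin : ∀ {n a} → Vec ℕ a → Pred (Permutation n n) 0ℓ
InverseDescentsWithin b π =
  ∀ j → Descent (Perm.flip π) j → ∃ λ i → position j ≡ partialSum b i

inverseDescentsWithin? : ∀ {n a} (b : Vec ℕ a) → Decidable (InverseDescentsWithin {n} b)
inverseDescentsWithin? b π = Fin.all? λ j →
  descent? (Perm.flip π) j →-dec Fin.any? (λ i → position j ℕ.≟ partialSum b i)

biasedShuffle : ∀ n {a} → Vector ℝ a → Measure n
biasedShuffle n {a} p π =
  ∑ (weakCompositions n a) λ b →
    (fromℕ (multinomial b) * product (λ i → p i ^ lookup b i)) * uniform (inverseDescentsWithin? b) π

{-# OPTIONS --safe #-}
-- Standardization turns the biased shuffle into sorting: if w is a word
-- of n independent letters with law p, then the ranks of its positions in the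
-- stable sort form a permutation with law P_{n,a;p}. For positions x < y the
-- ranks are inverted iff w x > w y, so sgn (π x) (π y) has mean
-- Σ_{c,d} p_c p_d (sgn c d + [c = d]) = Σ p_c², the sgn part cancelling by
-- antisymmetry. Hence sgn is an eigenfunction of the shuffle acting on pairs
-- with eigenvalue Σ p_c², and of its k-fold convolution with eigenvalue
-- (Σ p_c²)^k; summing [π x > π y] = (1 - sgn (π x) (π y)) / 2 over x < y gives
-- the formula.
module Submission where

open import Defs
open import Algebra.Bundles using (CommutativeRing)
open import Data.Bool using (true; false)
open import Data.Empty using (⊥-elim)
open import Data.Fin as Fin using (Fin; zero; suc; toℕ; fromℕ<; punchIn; inject₁)
import Data.Fin.Properties as Fin
open import Data.Fin.Permutation as Perm using (Permutation; _⟨$⟩ʳ_; _⟨$⟩ˡ_; insert; remove)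
open import Data.Integer as ℤ using (+_)
import Data.Integer.Properties as ℤ
open import Data.List as List using (List; []; _∷_; _++_; concatMap; allFin; upTo)
import Data.List.Properties as List
open import Data.List.Membership.Propositional using (_∈_)
open import Data.List.Membership.Propositional.Properties using (∈-allFin; ∈-upTo⁺)
open import Data.List.Relation.Unary.All as All using (All; []; _∷_)
open import Data.List.Relation.Unary.AllPairs using ([]; _∷_)
open import Data.List.Relation.Unary.Any using (here; there)
open import Data.List.Relation.Unary.Unique.Propositional using (Unique)
open import Data.List.Relation.Unary.Unique.Propositional.Properties using (allFin⁺; upTo⁺)
open import Data.Nat as ℕ using (ℕ; zero; suc; _≥_; _!; z≤n; s≤s)
import Data.Nat.Properties as ℕ
import Data.Nat.DivMod as ℕ
import Data.Nat.ListAction as ℕ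
open import Data.Nat.Combinatorics using (_C_)
import Data.Nat.Combinatorics as ℕ
open import Data.Product using (∃; ∃₂; _×_; _,_; proj₁; proj₂; uncurry)
open import Data.Rational as ℚ using (0ℚ; 1ℚ; ½; _/_)
import Data.Rational.Properties as ℚ
open import Data.Rational.Solver using (module +-*-Solver)
open import Data.Rational.Unnormalised as ℚᵘ using (mkℚᵘ; *≡*)
import Data.Rational.Unnormalised.Properties as ℚᵘ
open import Data.Sum using (_⊎_; inj₁; inj₂)
open import Data.Vec as Vec using (Vec; []; _∷_; lookup; toList; _[_]%=_)
import Data.Vec.Properties as Vec
open import Data.Vec.Functional using (Vector)
open import Function using (_∘_; id)
open import Relation.Binary using (DecidableEquality; Tri; tri<; tri≈; tri>)
open import Relation.Binary.PropositionalEquality as ≡ using (_≡_; _≢_; cong; cong₂; subst; subst₂)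
open import Relation.Nullary using (Dec; yes; no; does; ¬_; _×-dec_)
open import Relation.Unary using (Pred; Decidable)

-- The measure is defined through inverse descent sets, not through words. The bridge is that
-- `standardization` maps the words in which each letter occurs as often as `b` prescribes
-- bijectively onto the permutations whose inverse has its descents among the partial sums of `b`.
-- Hence there are multinomially many such permutations, the multinomial weight cancels the uniform
-- normalizer, and only the product of letter probabilities survives. Descent sets do not suit an
-- induction for surjectivity, since deleting a value makes its two neighbours adjacent; `Separated`
-- is a form of the condition that passes to the smaller permutation. The inversion indicator itself
-- is in general not an eigenfunction: earlier factors of a product hand a pair to the next factor
-- in either order, and the two orders have different inversion probabilities. Passing to `sgn`
-- makes both orders scale by the same factor.

-- How inserting one value shifts the others.

punchIn-< : ∀ {n} (j : Fin (suc n)) (u : Fin n) → u Fin.< j → toℕ (punchIn j u) ≡ toℕ u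
punchIn-< (suc j) zero    u<j       = ≡.refl
punchIn-< (suc j) (suc u) (s≤s u<j) = cong suc (punchIn-< j u u<j)

punchIn-≥ : ∀ {n} (j : Fin (suc n)) (u : Fin n) → j Fin.≤ u → toℕ (punchIn j u) ≡ suc (toℕ u)
punchIn-≥ zero    u       j≤u       = ≡.refl
punchIn-≥ (suc j) (suc u) (s≤s j≤u) = cong suc (punchIn-≥ j u j≤u)

≤punchIn : ∀ {n} (j : Fin (suc n)) (u : Fin n) → toℕ u ℕ.≤ toℕ (punchIn j u)
≤punchIn j u with ℕ.<-≤-connex (toℕ u) (toℕ j)
... | inj₁ u<j = ℕ.≤-reflexive (≡.sym (punchIn-< j u u<j))
... | inj₂ j≤u = ℕ.≤-trans (ℕ.n≤1+n _) (ℕ.≤-reflexive (≡.sym (punchIn-≥ j u j≤u)))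

punchIn≤ : ∀ {n} (j : Fin (suc n)) (u : Fin n) → toℕ (punchIn j u) ℕ.≤ suc (toℕ u)
punchIn≤ j u with ℕ.<-≤-connex (toℕ u) (toℕ j)
... | inj₁ u<j = ℕ.≤-trans (ℕ.≤-reflexive (punchIn-< j u u<j)) (ℕ.n≤1+n _)
... | inj₂ j≤u = ℕ.≤-reflexive (punchIn-≥ j u j≤u)

punchIn-mono-< : ∀ {n} (j : Fin (suc n)) {u v : Fin n} → u Fin.< v → punchIn j u Fin.< punchIn j v
punchIn-mono-< j {u} {v} u<v = ℕ.≰⇒> λ v≤u → ℕ.<⇒≱ u<v (Fin.punchIn-cancel-≤ j v u v≤u)

-- Block boundaries of a composition.

prefix : ∀ {a} → ℕ → Vec ℕ a → ℕ
prefix m b = ℕ.sum (List.take m (toList b))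

prefix-mono : ∀ {a} (b : Vec ℕ a) {l m} → l ℕ.≤ m → prefix l b ℕ.≤ prefix m b
prefix-mono b       {zero}          _         = z≤n
prefix-mono []      {suc l} {suc m} _         = z≤n
prefix-mono (k ∷ b) {suc l} {suc m} (s≤s l≤m) = ℕ.+-monoʳ-≤ k (prefix-mono b l≤m)

prefix-all : ∀ {a} (b : Vec ℕ a) → prefix a b ≡ Vec.sum b
prefix-all []      = ≡.refl
prefix-all (k ∷ b) = cong (k ℕ.+_) (prefix-all b)

prefix-replicate-0 : ∀ m a → prefix m (Vec.replicate a 0) ≡ 0
prefix-replicate-0 zero    a       = ≡.refl
prefix-replicate-0 (suc m) zero    = ≡.refl
prefix-replicate-0 (suc m) (suc a) = prefix-replicate-0 m a

prefix-updateAt-≤ : ∀ {a} (b : Vec ℕ a) (c : Fin a) {m} → m ℕ.≤ toℕ c →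
                    prefix m (b [ c ]%= suc) ≡ prefix m b
prefix-updateAt-≤ b       c       {zero}  _         = ≡.refl
prefix-updateAt-≤ (k ∷ b) (suc c) {suc m} (s≤s m≤c) = cong (k ℕ.+_) (prefix-updateAt-≤ b c m≤c)

prefix-updateAt-> : ∀ {a} (b : Vec ℕ a) (c : Fin a) {m} → toℕ c ℕ.< m →
                    prefix m (b [ c ]%= suc) ≡ suc (prefix m b)
prefix-updateAt-> (k ∷ b) zero    {suc m} _         = ≡.refl
prefix-updateAt-> (k ∷ b) (suc c) {suc m} (s≤s c<m) = begin
  k ℕ.+ prefix m (b [ c ]%= suc)   ≡⟨ cong (k ℕ.+_) (prefix-updateAt-> b c c<m) ⟩
  k ℕ.+ suc (prefix m b)           ≡⟨ ℕ.+-suc k (prefix m b) ⟩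
  suc (k ℕ.+ prefix m b)           ∎
  where open ≡.≡-Reasoning

sum-updateAt : ∀ {a} (b : Vec ℕ a) (c : Fin a) → Vec.sum (b [ c ]%= suc) ≡ suc (Vec.sum b)
sum-updateAt (k ∷ b) zero    = ≡.refl
sum-updateAt (k ∷ b) (suc c) = ≡.trans (cong (k ℕ.+_) (sum-updateAt b c)) (ℕ.+-suc k (Vec.sum b))

sum≡0⇒replicate-0 : ∀ {a} (b : Vec ℕ a) → Vec.sum b ≡ 0 → b ≡ Vec.replicate a 0
sum≡0⇒replicate-0 []         _      = ≡.refl
sum≡0⇒replicate-0 (zero ∷ b) sum≡0 = cong (0 ∷_) (sum≡0⇒replicate-0 b sum≡0)

sum-replicate-0 : ∀ a → Vec.sum (Vec.replicate a 0) ≡ 0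
sum-replicate-0 zero    = ≡.refl
sum-replicate-0 (suc a) = sum-replicate-0 a

-- The block of b containing the position m, with one element deleted from it.
block : ∀ {a} (b : Vec ℕ a) {m} → m ℕ.< Vec.sum b →
        ∃₂ λ (c : Fin a) (b′ : Vec ℕ a) →
          b ≡ b′ [ c ]%= suc × prefix (toℕ c) b′ ℕ.≤ m × m ℕ.≤ prefix (suc (toℕ c)) b′
block (k ∷ b) {m} m<sum with ℕ.<-≤-connex m k
block (suc k ∷ b) {m} m<sum | inj₁ (s≤s m≤k) =
  zero , k ∷ b , ≡.refl , z≤n , ℕ.≤-trans m≤k (ℕ.m≤m+n k _)
block (k ∷ b) {m} m<sum | inj₂ k≤m
  with (c , b′ , b≡ , low , high) ← block b (ℕ.+-cancelˡ-< k (m ℕ.∸ k) (Vec.sum b)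
         (subst (ℕ._< k ℕ.+ Vec.sum b) (≡.sym (ℕ.m+[n∸m]≡n k≤m)) m<sum)) =
  suc c , k ∷ b′ , cong (k ∷_) b≡
  , subst (k ℕ.+ prefix (toℕ c) b′ ℕ.≤_) (ℕ.m+[n∸m]≡n k≤m) (ℕ.+-monoʳ-≤ k low)
  , subst (ℕ._≤ k ℕ.+ prefix (suc (toℕ c)) b′) (ℕ.m+[n∸m]≡n k≤m) (ℕ.+-monoʳ-≤ k high)

-- Words and their standardization.

content : ∀ {a n} → Vec (Fin a) n → Vec ℕ a
content []      = Vec.replicate _ 0
content (c ∷ w) = content w [ c ]%= suc

sum-content : ∀ {a n} (w : Vec (Fin a) n) → Vec.sum (content w) ≡ n
sum-content {a} []  = sum-replicate-0 a
sum-content (c ∷ w) = ≡.trans (sum-updateAt (content w) c) (cong suc (sum-content w))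

-- Valued in `Fin (suc n)` so that the count can serve directly as the value inserted for a new
-- first letter `c`.
below : ∀ {a n} → Fin a → Vec (Fin a) n → Fin (suc n)
below c []      = zero
below c (d ∷ w) with d Fin.<? c
... | yes _ = suc (below c w)
... | no  _ = inject₁ (below c w)

toℕ-below : ∀ {a n} (c : Fin a) (w : Vec (Fin a) n) → toℕ (below c w) ≡ prefix (toℕ c) (content w)
toℕ-below {a} c []  = ≡.sym (prefix-replicate-0 (toℕ c) a)
toℕ-below c (d ∷ w) with d Fin.<? c
... | yes d<c = ≡.trans (cong suc (toℕ-below c w)) (≡.sym (prefix-updateAt-> (content w) d d<c))
... | no  d≮c = ≡.trans (Fin.toℕ-inject₁ (below c w)) (≡.trans (toℕ-below c w)
                  (≡.sym (prefix-updateAt-≤ (content w) d (ℕ.≮⇒≥ d≮c))))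

below-mono : ∀ {a n} (w : Vec (Fin a) n) {c d} → c Fin.≤ d → below c w Fin.≤ below d w
below-mono w {c} {d} c≤d = subst₂ ℕ._≤_ (≡.sym (toℕ-below c w)) (≡.sym (toℕ-below d w))
  (prefix-mono (content w) c≤d)

-- x goes to its rank in the stable sort of the positions by their letters:
-- zero is preceded exactly by the later letters below its own.
standardization : ∀ {a n} → Vec (Fin a) n → Permutation n n
standardization []      = Perm.id
standardization (c ∷ w) = insert zero (below c w) (standardization w)

-- `below c w` is the threshold between the ranks of letters under `c` and the rest. A new first
-- letter `d` under `c` raises the threshold by one and a rank by at most one. Any other `d` leaves
-- the threshold alone and is inserted at or above it, so the ranks under the threshold do not move.
standardization-<below : ∀ {a n} (w : Vec (Fin a) n) x {c} → lookup w x Fin.< c →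
                         standardization w ⟨$⟩ʳ x Fin.< below c w
standardization-<below (d ∷ w) x {c} wx<c with d Fin.<? c
standardization-<below (d ∷ w) zero    {c} wx<c | yes d<c = s≤s (below-mono w (ℕ.<⇒≤ d<c))
standardization-<below (d ∷ w) (suc x) {c} wx<c | yes d<c =
  s≤s (ℕ.≤-trans (punchIn≤ (below d w) _) (standardization-<below w x wx<c))
standardization-<below (d ∷ w) zero    {c} wx<c | no d≮c = ⊥-elim (d≮c wx<c)
standardization-<below (d ∷ w) (suc x) {c} wx<c | no d≮c = begin-strict
  toℕ (punchIn (below d w) (standardization w ⟨$⟩ʳ x))
    ≡⟨ punchIn-< (below d w) _ (ℕ.<-≤-trans rank<C (below-mono w (ℕ.≮⇒≥ d≮c))) ⟩
  toℕ (standardization w ⟨$⟩ʳ x)   <⟨ rank<C ⟩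
  toℕ (below c w)                  ≡⟨ Fin.toℕ-inject₁ (below c w) ⟨
  toℕ (inject₁ (below c w))        ∎
  where
  open ℕ.≤-Reasoning
  rank<C = standardization-<below w x wx<c

-- The other side of the threshold: if a new first letter raises it, that letter was inserted at or
-- below it and therefore lifts every rank from the threshold upwards; otherwise it is enough that
-- ranks never decrease.
below≤standardization : ∀ {a n} (w : Vec (Fin a) n) x {c} → c Fin.≤ lookup w x →
                        below c w Fin.≤ standardization w ⟨$⟩ʳ x
below≤standardization (d ∷ w) x {c} c≤wx with d Fin.<? c
below≤standardization (d ∷ w) zero    {c} c≤wx | yes d<c = ⊥-elim (ℕ.<⇒≱ d<c c≤wx)
below≤standardization (d ∷ w) (suc x) {c} c≤wx | yes d<c =
  subst (suc (toℕ (below c w)) ℕ.≤_)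
        (≡.sym (punchIn-≥ (below d w) _ (ℕ.≤-trans (below-mono w (ℕ.<⇒≤ d<c)) C≤rank)))
        (s≤s C≤rank)
  where C≤rank = below≤standardization w x c≤wx
below≤standardization (d ∷ w) zero    {c} c≤wx | no d≮c =
  subst (ℕ._≤ toℕ (below d w)) (≡.sym (Fin.toℕ-inject₁ (below c w))) (below-mono w c≤wx)
below≤standardization (d ∷ w) (suc x) {c} c≤wx | no d≮c =
  subst (ℕ._≤ _) (≡.sym (Fin.toℕ-inject₁ (below c w)))
        (ℕ.≤-trans (below≤standardization w x c≤wx) (≤punchIn (below d w) _))

standardization-< : ∀ {a n} (w : Vec (Fin a) n) {x y} → lookup w x Fin.< lookup w y →
                    standardization w ⟨$⟩ʳ x Fin.< standardization w ⟨$⟩ʳ y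
standardization-< w {x} {y} wx<wy =
  ℕ.<-≤-trans (standardization-<below w x wx<wy) (below≤standardization w y ℕ.≤-refl)

standardization-stable : ∀ {a n} (w : Vec (Fin a) n) {x y} → x Fin.< y →
                         lookup w x Fin.≤ lookup w y →
                         standardization w ⟨$⟩ʳ x Fin.< standardization w ⟨$⟩ʳ y
standardization-stable (c ∷ w) {zero} {suc y} _ c≤wy =
  ℕ.<-≤-trans (s≤s c-rank≤) (ℕ.≤-reflexive (≡.sym (punchIn-≥ (below c w) _ c-rank≤)))
  where c-rank≤ = below≤standardization w y c≤wy
standardization-stable (c ∷ w) {suc x} {suc y} (s≤s x<y) wx≤wy =
  punchIn-mono-< (below c w) (standardization-stable w x<y wx≤wy)

lookup-extensional : ∀ {A : Set} {n} (v w : Vec A n) → (∀ i → lookup v i ≡ lookup w i) → v ≡ w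
lookup-extensional v w eq =
  ≡.trans (≡.sym (Vec.tabulate∘lookup v)) (≡.trans (Vec.tabulate-cong eq) (Vec.tabulate∘lookup w))

-- The thresholds `below c` depend only on the content, and a letter can be read off from the
-- thresholds between which its rank lies. If `v` had a smaller letter than `w` at `x`, the common
-- rank would lie on both sides of the threshold of the larger letter.
standardization-injective : ∀ {a n} (v w : Vec (Fin a) n) → content v ≡ content w →
                            standardization v Perm.≈ standardization w → v ≡ w
standardization-injective v w v~w v≈w = lookup-extensional v w λ x →
  Fin.toℕ-injective (ℕ.≤-antisym (≤-letter w v (≡.sym v~w) (≡.sym ∘ v≈w) x) (≤-letter v w v~w v≈w x))
  where
  ≤-letter : ∀ {a n} (v w : Vec (Fin a) n) → content v ≡ content w →
             standardization v Perm.≈ standardization w → ∀ x → lookup w x Fin.≤ lookup v x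
  ≤-letter v w v~w v≈w x = ℕ.≮⇒≥ λ vx<wx → ℕ.<⇒≱
    (standardization-<below v x vx<wx)
    (subst₂ ℕ._≤_ (≡.trans (toℕ-below c w) (≡.trans (cong (prefix (toℕ c)) (≡.sym v~w)) (≡.sym (toℕ-below c v))))
                  (cong toℕ (≡.sym (v≈w x)))
                  (below≤standardization w x ℕ.≤-refl))
    where c = lookup w x

-- At a descent of the inverse, the ranks `j` and `j + 1` occur in reversed positions. By stability
-- their letters differ, so the threshold of the larger letter lies above `j` and at most at
-- `j + 1`. The descent at the last position is the total of the content.
standardization-inverseDescents : ∀ {a n} (w : Vec (Fin a) n) →
                                  InverseDescentsWithin (content w) (standardization w)
standardization-inverseDescents {suc a} {n} w j (inj₁ j-last) = Fin.fromℕ a , (begin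
  position j                              ≡⟨ j-last ⟩
  n                                       ≡⟨ sum-content w ⟨
  Vec.sum (content w)                     ≡⟨ prefix-all (content w) ⟨
  prefix (suc a) (content w)              ≡⟨ cong (λ m → prefix (suc m) (content w)) (Fin.toℕ-fromℕ a) ⟨
  partialSum (content w) (Fin.fromℕ a)    ∎)
  where open ≡.≡-Reasoning
standardization-inverseDescents {zero} (() ∷ w) j (inj₁ j-last)
standardization-inverseDescents {a} w j (inj₂ (j′ , j′≡1+j , x<y)) = partialSum-below (lookup w x) wy<wx
  (ℕ.≤-antisym (subst (λ r → suc (toℕ r) ℕ.≤ toℕ (below (lookup w x) w)) (Perm.inverseʳ π) (standardization-<below w y wy<wx))
               (subst (toℕ (below (lookup w x) w) ℕ.≤_) (≡.trans (cong toℕ (Perm.inverseʳ π)) j′≡1+j) (below≤standardization w x ℕ.≤-refl)))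
  where
  π = standardization w
  x = π ⟨$⟩ˡ j′
  y = π ⟨$⟩ˡ j
  wy<wx : lookup w y Fin.< lookup w x
  wy<wx = ℕ.≰⇒> λ wx≤wy → ℕ.<⇒≱ (standardization-stable w x<y wx≤wy)
    (subst₂ ℕ._≤_ (cong toℕ (≡.sym (Perm.inverseʳ π)))
                  (≡.trans (≡.sym j′≡1+j) (cong toℕ (≡.sym (Perm.inverseʳ π))))
                  (ℕ.n≤1+n (toℕ j)))
  -- The threshold of a letter sums the entries strictly before it, whereas `partialSum` at `i`
  -- includes entry `i`; so the witness is the predecessor of the letter, which exists because some
  -- letter lies below it.
  partialSum-below : ∀ c {d : Fin a} → d Fin.< c → position j ≡ toℕ (below c w) →
                     ∃ λ i → position j ≡ partialSum (content w) i
  partialSum-below (suc c) _ eq = inject₁ c ,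
    ≡.trans eq (≡.trans (toℕ-below (suc c) w)
      (cong (λ m → prefix (suc m) (content w)) (≡.sym (Fin.toℕ-inject₁ c))))

-- Surjectivity of standardization.

-- Inverted values lie in different blocks of `b`. It speaks of all inverted pairs rather than
-- adjacent values, which lets it survive the removal of a position together with its value.
Separated : ∀ {a n} → Vec ℕ a → Permutation n n → Set
Separated b π = ∀ {x y} → x Fin.< y → π ⟨$⟩ʳ y Fin.< π ⟨$⟩ʳ x →
  ∃ λ i → toℕ (π ⟨$⟩ʳ y) ℕ.< partialSum b i × partialSum b i ℕ.≤ toℕ (π ⟨$⟩ʳ x)

-- Walk up from `u`: either the next step descends, or the starting value has not decreased and the
-- walk goes on with a shorter distance `d`. At distance zero nothing can have fallen.
adjacent-descent : ∀ {n} (f : Fin n → Fin n) d {u v} → d ℕ.+ toℕ u ≡ toℕ v → f v Fin.< f u →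
                   ∃₂ λ j j′ → toℕ j′ ≡ suc (toℕ j) × f j′ Fin.< f j × u Fin.≤ j × j Fin.< v
adjacent-descent f zero    {u} {v} u≡v fv<fu =
  ⊥-elim (ℕ.<-irrefl (cong (toℕ ∘ f) (Fin.toℕ-injective (≡.sym u≡v))) fv<fu)
adjacent-descent {n} f (suc d) {u} {v} d+u≡v fv<fu with ℕ.<-≤-connex (toℕ (f u⁺)) (toℕ (f u))
  where
  u<v : u Fin.< v
  u<v = ℕ.≤-trans (s≤s (ℕ.m≤n+m (toℕ u) d)) (ℕ.≤-reflexive d+u≡v)
  u⁺<n : suc (toℕ u) ℕ.< n
  u⁺<n = ℕ.≤-<-trans u<v (Fin.toℕ<n v)
  u⁺ : Fin n
  u⁺ = fromℕ< u⁺<n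
... | inj₁ fu⁺<fu = u , _ , Fin.toℕ-fromℕ< _ , fu⁺<fu , ℕ.≤-refl ,
  ℕ.≤-trans (s≤s (ℕ.m≤n+m (toℕ u) d)) (ℕ.≤-reflexive d+u≡v)
... | inj₂ fu≤fu⁺
  with (j , j′ , j′≡ , desc , u⁺≤j , j<v) ← adjacent-descent f d
         (≡.trans (cong (d ℕ.+_) (Fin.toℕ-fromℕ< _)) (≡.trans (ℕ.+-suc d (toℕ u)) d+u≡v))
         (ℕ.<-≤-trans fv<fu fu≤fu⁺) =
  j , j′ , j′≡ , desc , ℕ.≤-trans (ℕ.n≤1+n _) (subst (ℕ._≤ toℕ j) (Fin.toℕ-fromℕ< _) u⁺≤j) , j<v

-- An inversion at `x`, `y` means that the inverse of `π` falls between the values `π y` and `π x`.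
-- It therefore has an adjacent descent in that range, and the position of this descent is the
-- required boundary.
inverseDescents⇒separated : ∀ {a n} (b : Vec ℕ a) (π : Permutation n n) →
                            InverseDescentsWithin b π → Separated b π
inverseDescents⇒separated b π within {x} {y} x<y πy<πx
  with (j , j′ , j′≡1+j , desc , πy≤j , j<πx) ←
         adjacent-descent (π ⟨$⟩ˡ_) _ (ℕ.m∸n+n≡m (ℕ.<⇒≤ πy<πx))
           (subst₂ Fin._<_ (≡.sym (Perm.inverseˡ π)) (≡.sym (Perm.inverseˡ π)) x<y)
  with (i , 1+j≡) ← within j (inj₂ (j′ , j′≡1+j , desc)) =
  i , subst (toℕ (π ⟨$⟩ʳ y) ℕ.<_) 1+j≡ (s≤s πy≤j) , subst (ℕ._≤ toℕ (π ⟨$⟩ʳ x)) 1+j≡ j<πx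

insert-cong : ∀ {n} (j : Fin (suc n)) {π σ : Permutation n n} → π Perm.≈ σ →
              insert zero j π Perm.≈ insert zero j σ
insert-cong j π≈σ zero    = ≡.refl
insert-cong j π≈σ (suc x) = cong (punchIn j) (π≈σ x)

module _ {a n} {b b′ : Vec ℕ a} {c : Fin a} (b≡ : b ≡ b′ [ c ]%= suc)
         (π : Permutation (suc n) (suc n)) (separated : Separated b π) where

  private
    j = π ⟨$⟩ʳ zero

    partialSum-≤ : ∀ i → suc (toℕ i) ℕ.≤ toℕ c → partialSum b i ≡ partialSum b′ i
    partialSum-≤ i i<c = ≡.trans (cong (λ b → partialSum b i) b≡) (prefix-updateAt-≤ b′ c i<c)

    partialSum-> : ∀ i → toℕ c ℕ.< suc (toℕ i) → partialSum b i ≡ suc (partialSum b′ i)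
    partialSum-> i c≤i = ≡.trans (cong (λ b → partialSum b i) b≡) (prefix-updateAt-> b′ c c≤i)

  -- Position zero must take the first value of its block. Otherwise that first value belongs to a
  -- later position, which gives an inversion inside one block: boundaries of index below `c` are at
  -- most `P`, all others exceed `j`.
  separated⇒head : Vec.sum b ≡ suc n →
                   prefix (toℕ c) b′ ℕ.≤ toℕ j → toℕ j ℕ.≤ prefix (suc (toℕ c)) b′ →
                   prefix (toℕ c) b′ ≡ toℕ j
  separated⇒head sum-b low high = ℕ.≤-antisym low (ℕ.≮⇒≥ absurd)
    where
    P = prefix (toℕ c) b′
    no-boundary : ∀ i → P ℕ.< partialSum b i → ¬ partialSum b i ℕ.≤ toℕ j
    no-boundary i P<B B≤j with ℕ.<-≤-connex (toℕ c) (suc (toℕ i))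
    ... | inj₁ c≤i = ℕ.<⇒≱ (subst (ℕ._≤ toℕ j) (partialSum-> i c≤i) B≤j)
                           (ℕ.≤-trans high (prefix-mono b′ c≤i))
    ... | inj₂ i<c = ℕ.<⇒≱ P<B (ℕ.≤-trans (ℕ.≤-reflexive (partialSum-≤ i i<c)) (prefix-mono b′ i<c))
    absurd : ¬ P ℕ.< toℕ j
    absurd P<j = contradict (π ⟨$⟩ˡ v) (Perm.inverseʳ π)
      where
      v : Fin (suc n)
      v = fromℕ< (ℕ.<-trans P<j (Fin.toℕ<n j))
      v≡P : toℕ v ≡ P
      v≡P = Fin.toℕ-fromℕ< _
      contradict : ∀ y → ¬ π ⟨$⟩ʳ y ≡ v
      contradict zero    πy≡v = ℕ.<-irrefl (≡.trans (≡.sym v≡P) (cong toℕ (≡.sym πy≡v))) P<j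
      contradict (suc y) πy≡v
        with πy≡P ← ≡.trans (cong toℕ πy≡v) v≡P
        with (i , πy<B , B≤j) ← separated {zero} {suc y} (s≤s z≤n) (subst (ℕ._< toℕ j) (≡.sym πy≡P) P<j) =
        no-boundary i (subst (ℕ._< partialSum b i) πy≡P πy<B) B≤j

  -- Removing the value `j` lowers all larger values by one, and shrinking block `c` lowers all
  -- boundaries from index `c` on by one. As `j` starts block `c`, the earlier boundaries are at
  -- most `j` and the lowered ones at least `j`, so a boundary between two values stays between
  -- them.
  separated⇒tail : prefix (toℕ c) b′ ≡ toℕ j → Separated b′ (remove zero π)
  separated⇒tail P≡j {x} {y} x<y π′y<π′x
    with (i , u<B , B≤v) ← separated (s≤s x<y)
           (subst₂ Fin._<_ (≡.sym (Perm.punchIn-permute π zero y)) (≡.sym (Perm.punchIn-permute π zero x))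
             (punchIn-mono-< j π′y<π′x))
    with u⁺<B ← subst (λ r → toℕ r ℕ.< partialSum b i) (Perm.punchIn-permute π zero y) u<B
       | B≤v⁺ ← subst (λ r → partialSum b i ℕ.≤ toℕ r) (Perm.punchIn-permute π zero x) B≤v
    with ℕ.<-≤-connex (toℕ c) (suc (toℕ i))
  ... | inj₁ c≤i = i , u<B′ , ℕ.s≤s⁻¹ (ℕ.≤-trans 1+B′≤v⁺ (punchIn≤ j v))
    where
    u = remove zero π ⟨$⟩ʳ y
    v = remove zero π ⟨$⟩ʳ x
    u⁺<1+B′ = subst (toℕ (punchIn j u) ℕ.<_) (partialSum-> i c≤i) u⁺<B
    1+B′≤v⁺ = subst (ℕ._≤ toℕ (punchIn j v)) (partialSum-> i c≤i) B≤v⁺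
    u<B′ : toℕ u ℕ.< partialSum b′ i
    u<B′ with ℕ.<-≤-connex (toℕ u) (toℕ j)
    ... | inj₁ u<j = ℕ.<-≤-trans u<j (subst (ℕ._≤ partialSum b′ i) P≡j (prefix-mono b′ (ℕ.<⇒≤ c≤i)))
    ... | inj₂ j≤u = ℕ.s≤s⁻¹ (subst (ℕ._< suc (partialSum b′ i)) (punchIn-≥ j u j≤u) u⁺<1+B′)
  ... | inj₂ i<c = i , ℕ.≤-<-trans (≤punchIn j u) u⁺<B′ , B′≤v
    where
    u = remove zero π ⟨$⟩ʳ y
    v = remove zero π ⟨$⟩ʳ x
    u⁺<B′ = subst (toℕ (punchIn j u) ℕ.<_) (partialSum-≤ i i<c) u⁺<B
    B′≤v⁺ = subst (ℕ._≤ toℕ (punchIn j v)) (partialSum-≤ i i<c) B≤v⁺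
    B′≤v : partialSum b′ i ℕ.≤ toℕ v
    B′≤v with ℕ.<-≤-connex (toℕ v) (toℕ j)
    ... | inj₁ v<j = subst (partialSum b′ i ℕ.≤_) (punchIn-< j v v<j) B′≤v⁺
    ... | inj₂ j≤v = ℕ.≤-trans (subst (partialSum b′ i ℕ.≤_) P≡j (prefix-mono b′ i<c)) j≤v

-- The first letter is the index of the block that contains `π zero`; the other letters come from
-- the permutation left after removing position zero. Since `π zero` starts its block, it equals the
-- number of later smaller letters, which is where `standardization` inserts.
standardization-surjective : ∀ {a} n (b : Vec ℕ a) (π : Permutation n n) → Vec.sum b ≡ n →
                             Separated b π →
                             ∃ λ w → content w ≡ b × standardization w Perm.≈ π
standardization-surjective zero    b π sum-b separated =
  [] , ≡.sym (sum≡0⇒replicate-0 b sum-b) , λ ()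
standardization-surjective (suc n) b π sum-b separated
  with (c , b′ , b≡ , low , high) ← block b (subst (toℕ (π ⟨$⟩ʳ zero) ℕ.<_) (≡.sym sum-b) (Fin.toℕ<n (π ⟨$⟩ʳ zero)))
  with P≡j ← separated⇒head b≡ π separated sum-b low high
  with (w , w~b′ , w≈) ← standardization-surjective n b′ (remove zero π)
         (ℕ.suc-injective (≡.trans (≡.sym (≡.trans (cong Vec.sum b≡) (sum-updateAt b′ c))) sum-b))
         (separated⇒tail b≡ π separated P≡j) =
  c ∷ w , ≡.trans (cong (_[ c ]%= suc) w~b′) (≡.sym b≡) , λ x → begin
    insert zero (below c w) (standardization w) ⟨$⟩ʳ x
      ≡⟨ cong (λ j → insert zero j (standardization w) ⟨$⟩ʳ x) (Fin.toℕ-injective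
           (≡.trans (toℕ-below c w) (≡.trans (cong (prefix (toℕ c)) w~b′) P≡j))) ⟩
    insert zero (π ⟨$⟩ʳ zero) (standardization w) ⟨$⟩ʳ x
      ≡⟨ insert-cong (π ⟨$⟩ʳ zero) {standardization w} {remove zero π} w≈ x ⟩
    insert zero (π ⟨$⟩ʳ zero) (remove zero π) ⟨$⟩ʳ x
      ≡⟨ Perm.insert-remove zero π x ⟩
    π ⟨$⟩ʳ x  ∎
  where open ≡.≡-Reasoning

-- Insertion codes, products of factorials and one-letter changes of content.

insert-≈⁻ : ∀ {n} (j : Fin (suc n)) (π : Permutation n n) (ρ : Permutation (suc n) (suc n)) →
            insert zero j π Perm.≈ ρ → j ≡ ρ ⟨$⟩ʳ zero × π Perm.≈ remove zero ρ
insert-≈⁻ j π ρ eq = eq zero , λ x → Fin.punchIn-injective j _ _ (begin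
  punchIn j (π ⟨$⟩ʳ x)                                ≡⟨ eq (suc x) ⟩
  ρ ⟨$⟩ʳ suc x                                        ≡⟨ Perm.punchIn-permute ρ zero x ⟩
  punchIn (ρ ⟨$⟩ʳ zero) (remove zero ρ ⟨$⟩ʳ x)        ≡⟨ cong (λ j → punchIn j (remove zero ρ ⟨$⟩ʳ x)) (eq zero) ⟨
  punchIn j (remove zero ρ ⟨$⟩ʳ x)                    ∎)
  where open ≡.≡-Reasoning

insert-≈⁺ : ∀ {n} (j : Fin (suc n)) (π : Permutation n n) (ρ : Permutation (suc n) (suc n)) →
            j ≡ ρ ⟨$⟩ʳ zero → π Perm.≈ remove zero ρ → insert zero j π Perm.≈ ρ
insert-≈⁺ j π ρ ≡.refl π≈ x =
  ≡.trans (insert-cong j {π} {remove zero ρ} π≈ x) (Perm.insert-remove zero ρ x)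

factorials : ∀ {a} → Vec ℕ a → ℕ
factorials b = ℕ.product (List.map _! (toList b))

factorials-updateAt : ∀ {a} (b : Vec ℕ a) (c : Fin a) →
                      factorials (b [ c ]%= suc) ≡ suc (lookup b c) ℕ.* factorials b
factorials-updateAt (k ∷ b) zero    = ℕ.*-assoc (suc k) (k !) (factorials b)
factorials-updateAt (k ∷ b) (suc c) = begin
  k ! ℕ.* factorials (b [ c ]%= suc)              ≡⟨ cong (k ! ℕ.*_) (factorials-updateAt b c) ⟩
  k ! ℕ.* (suc (lookup b c) ℕ.* factorials b)     ≡⟨ x∙yz≈y∙xz (k !) (suc (lookup b c)) (factorials b) ⟩
  suc (lookup b c) ℕ.* (k ! ℕ.* factorials b)     ∎
  where
  open ≡.≡-Reasoning
  open import Algebra.Properties.CommutativeSemigroup ℕ.*-commutativeSemigroup using (x∙yz≈y∙xz)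

decrement : ∀ {a} (b : Vec ℕ a) c → lookup b c ≡ 0 ⊎ ∃ λ b′ → b ≡ b′ [ c ]%= suc
decrement (zero  ∷ b) zero = inj₁ ≡.refl
decrement (suc k ∷ b) zero = inj₂ (k ∷ b , ≡.refl)
decrement (k ∷ b) (suc c) with decrement b c
... | inj₁ eq        = inj₁ eq
... | inj₂ (b′ , eq) = inj₂ (k ∷ b′ , cong (k ∷_) eq)

updateAt-suc-injective : ∀ {a} (b b′ : Vec ℕ a) c → b [ c ]%= suc ≡ b′ [ c ]%= suc → b ≡ b′
updateAt-suc-injective (k ∷ b) (l ∷ b′) zero    eq with Vec.∷-injective eq
... | 1+k≡1+l , b≡b′ = cong₂ _∷_ (ℕ.suc-injective 1+k≡1+l) b≡b′
updateAt-suc-injective (k ∷ b) (l ∷ b′) (suc c) eq with Vec.∷-injective eq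
... | k≡l , eq′ = cong₂ _∷_ k≡l (updateAt-suc-injective b b′ c eq′)

-- Finite sums of real numbers.

open CommutativeRing commutativeRing
  using (setoid; +-assoc; +-identityˡ; +-identityʳ; -‿inverseʳ
        ; *-assoc; *-comm; *-identityˡ; *-identityʳ; distribˡ; zeroˡ; zeroʳ)
  renaming (refl to ≈-refl; reflexive to ≈-reflexive)
open import Relation.Binary.Reasoning.Setoid setoid

private variable
  A B : Set

*-congˡ : ∀ x {y z} → y ≈ z → x * y ≈ x * z
*-congˡ x y≈z = *-cong (≈-refl {x}) y≈z

*-congʳ : ∀ x {y z} → y ≈ z → y * x ≈ z * x
*-congʳ x y≈z = *-cong y≈z (≈-refl {x})

-- The operations on ℝ act termwise, so a ring identity holds because the rational identity holds at
-- every index of the sequences. Later rearrangements use the same device.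
*-leftComm : ∀ x y z → x * (y * z) ≈ y * (x * z)
*-leftComm x y z = pointwise⇒≈ λ n →
  solve 3 (λ p q r → p :* (q :* r) := q :* (p :* r)) ≡.refl (seq x n) (seq y n) (seq z n)
  where open +-*-Solver

∑-cong : (xs : List A) {f g : A → ℝ} → (∀ x → f x ≈ g x) → ∑ xs f ≈ ∑ xs g
∑-cong []       f≈g = ≈-refl
∑-cong (x ∷ xs) f≈g = +-cong (f≈g x) (∑-cong xs f≈g)

∑-map : (h : A → B) (xs : List A) (f : B → ℝ) → ∑ (List.map h xs) f ≡ ∑ xs (f ∘ h)
∑-map h xs f = cong (List.foldr _+_ 0ℝ) (≡.sym (List.map-∘ xs))

∑-++ : (xs ys : List A) (f : A → ℝ) → ∑ (xs ++ ys) f ≈ ∑ xs f + ∑ ys f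
∑-++ []       ys f = ≈-sym (+-identityˡ _)
∑-++ (x ∷ xs) ys f = begin
  f x + ∑ (xs ++ ys) f       ≈⟨ +-cong ≈-refl (∑-++ xs ys f) ⟩
  f x + (∑ xs f + ∑ ys f)    ≈⟨ +-assoc _ _ _ ⟨
  (f x + ∑ xs f) + ∑ ys f    ∎

∑-concatMap : (h : A → List B) (xs : List A) (f : B → ℝ) →
              ∑ (concatMap h xs) f ≈ ∑ xs (λ x → ∑ (h x) f)
∑-concatMap h []       f = ≈-refl
∑-concatMap h (x ∷ xs) f = begin
  ∑ (h x ++ concatMap h xs) f          ≈⟨ ∑-++ (h x) (concatMap h xs) f ⟩
  ∑ (h x) f + ∑ (concatMap h xs) f     ≈⟨ +-cong ≈-refl (∑-concatMap h xs f) ⟩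
  ∑ (h x) f + ∑ xs (λ x → ∑ (h x) f)   ∎

∑-zero : (xs : List A) → ∑ xs (λ _ → 0ℝ) ≈ 0ℝ
∑-zero []       = ≈-refl
∑-zero (x ∷ xs) = ≈-trans (+-identityˡ _) (∑-zero xs)

∑-+ : (xs : List A) (f g : A → ℝ) → ∑ xs (λ x → f x + g x) ≈ ∑ xs f + ∑ xs g
∑-+ []       f g = ≈-sym (+-identityˡ _)
∑-+ (x ∷ xs) f g = begin
  (f x + g x) + ∑ xs (λ x → f x + g x)   ≈⟨ +-cong ≈-refl (∑-+ xs f g) ⟩
  (f x + g x) + (∑ xs f + ∑ xs g)        ≈⟨ exchange (f x) (g x) (∑ xs f) (∑ xs g) ⟩
  (f x + ∑ xs f) + (g x + ∑ xs g)        ∎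
  where
  exchange : ∀ a b c d → (a + b) + (c + d) ≈ (a + c) + (b + d)
  exchange a b c d = pointwise⇒≈ λ n →
    solve 4 (λ p q r s → (p :+ q) :+ (r :+ s) := (p :+ r) :+ (q :+ s)) ≡.refl
      (seq a n) (seq b n) (seq c n) (seq d n)
    where open +-*-Solver

∑-*ˡ : (xs : List A) (c : ℝ) (f : A → ℝ) → ∑ xs (λ x → c * f x) ≈ c * ∑ xs f
∑-*ˡ []       c f = ≈-sym (zeroʳ c)
∑-*ˡ (x ∷ xs) c f = begin
  c * f x + ∑ xs (λ x → c * f x)   ≈⟨ +-cong ≈-refl (∑-*ˡ xs c f) ⟩
  c * f x + c * ∑ xs f             ≈⟨ distribˡ c (f x) (∑ xs f) ⟨
  c * (f x + ∑ xs f)               ∎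

∑-*ʳ : (xs : List A) (c : ℝ) (f : A → ℝ) → ∑ xs (λ x → f x * c) ≈ ∑ xs f * c
∑-*ʳ xs c f = begin
  ∑ xs (λ x → f x * c)   ≈⟨ ∑-cong xs (λ x → *-comm (f x) c) ⟩
  ∑ xs (λ x → c * f x)   ≈⟨ ∑-*ˡ xs c f ⟩
  c * ∑ xs f             ≈⟨ *-comm c (∑ xs f) ⟩
  ∑ xs f * c             ∎

-1*_ : ∀ x → (- 1ℝ) * x ≈ - x
-1* x = pointwise⇒≈ λ n →
  ≡.trans (≡.sym (ℚ.neg-distribˡ-* 1ℚ (seq x n))) (cong ℚ.-_ (ℚ.*-identityˡ (seq x n)))

∑-- : (xs : List A) (f g : A → ℝ) → ∑ xs (λ x → f x - g x) ≈ ∑ xs f - ∑ xs g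
∑-- xs f g = begin
  ∑ xs (λ x → f x - g x)                ≈⟨ ∑-+ xs f (λ x → - g x) ⟩
  ∑ xs f + ∑ xs (λ x → - g x)           ≈⟨ +-cong ≈-refl (∑-cong xs (λ x → ≈-sym (-1* g x))) ⟩
  ∑ xs f + ∑ xs (λ x → (- 1ℝ) * g x)    ≈⟨ +-cong ≈-refl (∑-*ˡ xs (- 1ℝ) g) ⟩
  ∑ xs f + (- 1ℝ) * ∑ xs g              ≈⟨ +-cong ≈-refl (-1* ∑ xs g) ⟩
  ∑ xs f - ∑ xs g                       ∎

∑-swap : (xs : List A) (ys : List B) (f : A → B → ℝ) →
         ∑ xs (λ x → ∑ ys (f x)) ≈ ∑ ys (λ y → ∑ xs (λ x → f x y))
∑-swap []       ys f = ≈-sym (∑-zero ys)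
∑-swap (x ∷ xs) ys f = begin
  ∑ ys (f x) + ∑ xs (λ x → ∑ ys (f x))           ≈⟨ +-cong ≈-refl (∑-swap xs ys f) ⟩
  ∑ ys (f x) + ∑ ys (λ y → ∑ xs (λ x → f x y))   ≈⟨ ∑-+ ys (f x) (λ y → ∑ xs (λ x → f x y)) ⟨
  ∑ ys (λ y → f x y + ∑ xs (λ x → f x y))        ∎

∑-filter : {P : Pred A _} (P? : Decidable P) (xs : List A) (f : A → ℝ) →
           ∑ (List.filter P? xs) f ≈ ∑ xs (λ x → indicator (P? x) * f x)
∑-filter P? []       f = ≈-refl
∑-filter P? (x ∷ xs) f with does (P? x)
... | true  = +-cong (≈-sym (*-identityˡ _)) (∑-filter P? xs f)
... | false = begin
  ∑ (List.filter P? xs) f                             ≈⟨ ∑-filter P? xs f ⟩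
  ∑ xs (λ x → indicator (P? x) * f x)                 ≈⟨ +-identityˡ _ ⟨
  0ℝ + ∑ xs (λ x → indicator (P? x) * f x)            ≈⟨ +-cong (zeroˡ (f x)) ≈-refl ⟨
  0ℝ * f x + ∑ xs (λ x → indicator (P? x) * f x)      ∎

∑-cartesianProduct : (xs : List A) (ys : List B) (f : A × B → ℝ) →
                     ∑ (List.cartesianProduct xs ys) f ≈ ∑ xs (λ x → ∑ ys (λ y → f (x , y)))
∑-cartesianProduct []       ys f = ≈-refl
∑-cartesianProduct (x ∷ xs) ys f = begin
  ∑ (List.map (x ,_) ys ++ List.cartesianProduct xs ys) f
    ≈⟨ ∑-++ (List.map (x ,_) ys) (List.cartesianProduct xs ys) f ⟩
  ∑ (List.map (x ,_) ys) f + ∑ (List.cartesianProduct xs ys) f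
    ≈⟨ +-cong (≈-reflexive (∑-map (x ,_) ys f)) (∑-cartesianProduct xs ys f) ⟩
  ∑ ys (λ y → f (x , y)) + ∑ xs (λ x → ∑ ys (λ y → f (x , y)))  ∎

-- Indicators and their sifting property.

indicator-true : {P : Set} (P? : Dec P) → P → indicator P? ≡ 1ℝ
indicator-true (yes _) _ = ≡.refl
indicator-true (no ¬p) p = ⊥-elim (¬p p)

indicator-false : {P : Set} (P? : Dec P) → ¬ P → indicator P? ≡ 0ℝ
indicator-false (yes p) ¬p = ⊥-elim (¬p p)
indicator-false (no _)  _  = ≡.refl

indicator-⇔ : {P Q : Set} (P? : Dec P) (Q? : Dec Q) → (P → Q) → (Q → P) → indicator P? ≡ indicator Q?
indicator-⇔ (yes p) Q? to from = ≡.sym (indicator-true Q? (to p))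
indicator-⇔ (no ¬p) Q? to from = ≡.sym (indicator-false Q? (¬p ∘ from))

indicator-× : {P Q : Set} (P? : Dec P) (Q? : Dec Q) →
              indicator (P? ×-dec Q?) ≈ indicator P? * indicator Q?
indicator-× P? Q? with does P?
... | true  = ≈-sym (*-identityˡ _)
... | false = ≈-sym (zeroˡ _)

∑-indicator : {_≟_ : DecidableEquality A} {y : A} {xs : List A} → Unique xs → y ∈ xs →
              (f : A → ℝ) → ∑ xs (λ x → indicator (x ≟ y) * f x) ≈ f y
∑-indicator {_≟_ = _≟_} {y} {xs = x ∷ xs} (x∉xs ∷ xs!) (here ≡.refl) f = begin
  indicator (x ≟ x) * f x + ∑ xs (λ z → indicator (z ≟ x) * f z)
    ≈⟨ +-cong (*-congʳ (f x) (≈-reflexive (indicator-true (x ≟ x) ≡.refl))) (rest xs x∉xs) ⟩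
  1ℝ * f x + 0ℝ   ≈⟨ +-identityʳ _ ⟩
  1ℝ * f x        ≈⟨ *-identityˡ (f x) ⟩
  f x             ∎
  where
  rest : ∀ zs → All (x ≢_) zs → ∑ zs (λ z → indicator (z ≟ x) * f z) ≈ 0ℝ
  rest []       []           = ≈-refl
  rest (z ∷ zs) (x≢z ∷ x∉zs) = begin
    indicator (z ≟ x) * f z + ∑ zs (λ z → indicator (z ≟ x) * f z)
      ≈⟨ +-cong (*-congʳ (f z) (≈-reflexive (indicator-false (z ≟ x) (x≢z ∘ ≡.sym)))) (rest zs x∉zs) ⟩
    0ℝ * f z + 0ℝ   ≈⟨ +-identityʳ _ ⟩
    0ℝ * f z        ≈⟨ zeroˡ (f z) ⟩
    0ℝ              ∎
∑-indicator {_≟_ = _≟_} {y} {xs = x ∷ xs} (x∉xs ∷ xs!) (there y∈xs) f = begin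
  indicator (x ≟ y) * f x + ∑ xs (λ z → indicator (z ≟ y) * f z)
    ≈⟨ +-cong (*-congʳ (f x) (≈-reflexive (indicator-false (x ≟ y) (All.lookup x∉xs y∈xs))))
              (∑-indicator {_≟_ = _≟_} xs! y∈xs f) ⟩
  0ℝ * f x + f y   ≈⟨ +-cong (zeroˡ (f x)) ≈-refl ⟩
  0ℝ + f y         ≈⟨ +-identityˡ (f y) ⟩
  f y              ∎

∑-allFin : ∀ n (f : Fin (suc n) → ℝ) → ∑ (allFin (suc n)) f ≈ f zero + ∑ (allFin n) (f ∘ suc)
∑-allFin n f = +-cong ≈-refl (≈-reflexive
  (≡.trans (cong (λ xs → ∑ xs f) (≡.sym (List.map-tabulate id suc))) (∑-map suc (allFin n) f)))

∑-allFin-sum : ∀ n (f : Fin n → ℝ) → ∑ (allFin n) f ≈ sum f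
∑-allFin-sum zero    f = ≈-refl
∑-allFin-sum (suc n) f = ≈-trans (∑-allFin n f) (+-cong ≈-refl (∑-allFin-sum n (f ∘ suc)))

-- Natural and rational numbers inside ℝ.

-- Unnormalised fractions add and multiply without reduction to lowest terms, so the identities
-- below become integer equations between numerators and denominators.
fromℚᵘ-homo-+ : ∀ p q → ℚ.fromℚᵘ (p ℚᵘ.+ q) ≡ ℚ.fromℚᵘ p ℚ.+ ℚ.fromℚᵘ q
fromℚᵘ-homo-+ p q = ℚ.toℚᵘ-injective (ℚᵘ.≃-trans (ℚ.toℚᵘ-fromℚᵘ (p ℚᵘ.+ q)) (ℚᵘ.≃-sym
  (ℚᵘ.≃-trans (ℚ.toℚᵘ-homo-+ (ℚ.fromℚᵘ p) (ℚ.fromℚᵘ q))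
              (ℚᵘ.+-cong (ℚ.toℚᵘ-fromℚᵘ p) (ℚ.toℚᵘ-fromℚᵘ q)))))

fromℚᵘ-homo-* : ∀ p q → ℚ.fromℚᵘ (p ℚᵘ.* q) ≡ ℚ.fromℚᵘ p ℚ.* ℚ.fromℚᵘ q
fromℚᵘ-homo-* p q = ℚ.toℚᵘ-injective (ℚᵘ.≃-trans (ℚ.toℚᵘ-fromℚᵘ (p ℚᵘ.* q)) (ℚᵘ.≃-sym
  (ℚᵘ.≃-trans (ℚ.toℚᵘ-homo-* (ℚ.fromℚᵘ p) (ℚ.fromℚᵘ q))
              (ℚᵘ.*-cong (ℚ.toℚᵘ-fromℚᵘ p) (ℚ.toℚᵘ-fromℚᵘ q)))))

fromℕ-+ : ∀ m n → fromℕ (m ℕ.+ n) ≈ fromℕ m + fromℕ n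
fromℕ-+ m n = pointwise⇒≈ λ _ → ≡.trans
  (ℚ.fromℚᵘ-cong {mkℚᵘ (+ (m ℕ.+ n)) 0} {mkℚᵘ (+ m) 0 ℚᵘ.+ mkℚᵘ (+ n) 0}
    (*≡* (cong (ℤ._* + 1) (≡.sym (cong₂ ℤ._+_ (ℤ.*-identityʳ (+ m)) (ℤ.*-identityʳ (+ n)))))))
  (fromℚᵘ-homo-+ (mkℚᵘ (+ m) 0) (mkℚᵘ (+ n) 0))

fromℕ-* : ∀ m n → fromℕ (m ℕ.* n) ≈ fromℕ m * fromℕ n
fromℕ-* m n = pointwise⇒≈ λ _ → ≡.trans
  (ℚ.fromℚᵘ-cong {mkℚᵘ (+ (m ℕ.* n)) 0} {mkℚᵘ (+ m) 0 ℚᵘ.* mkℚᵘ (+ n) 0}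
    (*≡* (cong (ℤ._* + 1) (ℤ.pos-* m n))))
  (fromℚᵘ-homo-* (mkℚᵘ (+ m) 0) (mkℚᵘ (+ n) 0))

fromℕ-*-reciprocal : ∀ m → m ≢ 0 → fromℕ m * reciprocal m ≈ 1ℝ
fromℕ-*-reciprocal zero    m≢0 = ⊥-elim (m≢0 ≡.refl)
fromℕ-*-reciprocal (suc m) _   = pointwise⇒≈ λ _ → ≡.trans
  (≡.sym (fromℚᵘ-homo-* (mkℚᵘ (+ suc m) 0) (mkℚᵘ (+ 1) m)))
  (ℚ.fromℚᵘ-cong {mkℚᵘ (+ suc m) 0 ℚᵘ.* mkℚᵘ (+ 1) m} {mkℚᵘ (+ 1) 0}
    (*≡* (≡.trans (cong (ℤ._* + 1) (ℤ.*-identityʳ (+ suc m)))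
         (≡.trans (ℤ.*-identityʳ (+ suc m))
         (≡.sym (≡.trans (ℤ.*-identityˡ _) (cong +_ (ℕ.*-identityˡ (suc m)))))))))

fromℚ-/2 : ∀ m → fromℚ (+ m / 2) ≈ fromℚ ½ * fromℕ m
fromℚ-/2 m = pointwise⇒≈ λ _ → ≡.trans
  (ℚ.fromℚᵘ-cong {mkℚᵘ (+ m) 1} {mkℚᵘ (+ 1) 1 ℚᵘ.* mkℚᵘ (+ m) 0}
    (*≡* (cong (ℤ._* + 2) (≡.sym (ℤ.*-identityˡ (+ m))))))
  (fromℚᵘ-homo-* (mkℚᵘ (+ 1) 1) (mkℚᵘ (+ m) 0))

-- A constant sequence that vanishes in the limit is zero: take the absolute value of `p - q` itself
-- as the tolerance.
fromℚ-injective : ∀ {p q} → fromℚ p ≈ fromℚ q → p ≡ q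
fromℚ-injective {p} {q} (mk≈ (vanishing small)) with p ℚ.- q ℚ.≟ 0ℚ
... | yes p-q≡0 = ≡.trans (split p q) (≡.trans (cong (ℚ._+ q) p-q≡0) (ℚ.+-identityˡ q))
  where
  split : ∀ p q → p ≡ (p ℚ.- q) ℚ.+ q
  split = solve 2 (λ p q → p := (p :- q) :+ q) ≡.refl
    where open +-*-Solver
... | no  p-q≢0 = ⊥-elim (ℚ.<-irrefl ≡.refl (proj₂ (small 0<∣p-q∣) _ ℕ.≤-refl))
  where
  0<∣p-q∣ : 0ℚ ℚ.< ℚ.∣ p ℚ.- q ∣
  0<∣p-q∣ = ℚ.≰⇒> λ ∣p-q∣≤0 → p-q≢0 (ℚ.∣p∣≡0⇒p≡0 _ (ℚ.≤-antisym ∣p-q∣≤0 (ℚ.0≤∣p∣ (p ℚ.- q))))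

-- Brings counting identities obtained as real sums back to ℕ, where `multinomial` is an integer
-- quotient.
fromℕ-injective : ∀ {m n} → fromℕ m ≈ fromℕ n → m ≡ n
fromℕ-injective {m} {n} eq with ℚ.fromℚᵘ-injective {mkℚᵘ (+ m) 0} {mkℚᵘ (+ n) 0} (fromℚ-injective eq)
... | *≡* m*1≡n*1 = ℤ.+-injective (ℤ.*-cancelʳ-≡ (+ m) (+ n) (+ 1) m*1≡n*1)

fromℕ-length : (xs : List A) → fromℕ (List.length xs) ≈ ∑ xs (λ _ → 1ℝ)
fromℕ-length []       = ≈-refl
fromℕ-length (x ∷ xs) = ≈-trans (fromℕ-+ 1 (List.length xs)) (+-cong ≈-refl (fromℕ-length xs))

fromℕ-length-filter : {P : Pred A _} (P? : Decidable P) (xs : List A) →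
                      fromℕ (List.length (List.filter P? xs)) ≈ ∑ xs (λ x → indicator (P? x))
fromℕ-length-filter P? xs = begin
  fromℕ (List.length (List.filter P? xs))     ≈⟨ fromℕ-length (List.filter P? xs) ⟩
  ∑ (List.filter P? xs) (λ _ → 1ℝ)            ≈⟨ ∑-filter P? xs (λ _ → 1ℝ) ⟩
  ∑ xs (λ x → indicator (P? x) * 1ℝ)          ≈⟨ ∑-cong xs (λ x → *-identityʳ _) ⟩
  ∑ xs (λ x → indicator (P? x))               ∎

-- Sums over permutations and tuples.

-- A `Permutation` also carries its inverse and proofs, and `permutations` lists one representative
-- of each class of `≈`; moving a summand to another representative requires this invariance.
RespectsPerm : ∀ {n} → (Permutation n n → ℝ) → Set
RespectsPerm f = ∀ {π σ} → π Perm.≈ σ → f π ≈ f σ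

-- The list meets the class of `ρ` exactly once: a permutation is determined by its value at zero
-- and by what remains after removing zero, so the indicator factors along the recursion that
-- generates the list.
∑-permutations : ∀ n (ρ : Permutation n n) (f : Permutation n n → ℝ) → RespectsPerm f →
                 ∑ (permutations n) (λ π → indicator (π ≟ₚ ρ) * f π) ≈ f ρ
∑-permutations zero ρ f f-resp = begin
  1ℝ * f Perm.id + 0ℝ   ≈⟨ +-identityʳ _ ⟩
  1ℝ * f Perm.id        ≈⟨ *-identityˡ _ ⟩
  f Perm.id             ≈⟨ f-resp (λ ()) ⟩
  f ρ                   ∎
∑-permutations (suc n) ρ f f-resp = begin
  ∑ (permutations (suc n)) F
    ≈⟨ ∑-concatMap (λ j → List.map (insert zero j) (permutations n)) (allFin (suc n)) F ⟩
  ∑ (allFin (suc n)) (λ j → ∑ (List.map (insert zero j) (permutations n)) F)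
    ≈⟨ ∑-cong (allFin (suc n)) (λ j → ≈-reflexive (∑-map (insert zero j) (permutations n) F)) ⟩
  ∑ (allFin (suc n)) (λ j → ∑ (permutations n) (λ π → F (insert zero j π)))
    ≈⟨ ∑-cong (allFin (suc n)) (λ j → ∑-cong (permutations n) (λ π → split j π)) ⟩
  ∑ (allFin (suc n)) (λ j → ∑ (permutations n) (λ π →
    indicator (j Fin.≟ j₀) * (indicator (π ≟ₚ remove zero ρ) * f (insert zero j π))))
    ≈⟨ ∑-cong (allFin (suc n)) (λ j → ∑-*ˡ (permutations n) (indicator (j Fin.≟ j₀))
         (λ π → indicator (π ≟ₚ remove zero ρ) * f (insert zero j π))) ⟩
  ∑ (allFin (suc n)) (λ j → indicator (j Fin.≟ j₀) *
    ∑ (permutations n) (λ π → indicator (π ≟ₚ remove zero ρ) * f (insert zero j π)))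
    ≈⟨ ∑-cong (allFin (suc n)) (λ j → *-congˡ (indicator (j Fin.≟ j₀))
         (∑-permutations n (remove zero ρ) (λ π → f (insert zero j π))
           (λ {π} {σ} π≈σ → f-resp (insert-cong j {π} {σ} π≈σ)))) ⟩
  ∑ (allFin (suc n)) (λ j → indicator (j Fin.≟ j₀) * f (insert zero j (remove zero ρ)))
    ≈⟨ ∑-indicator {_≟_ = Fin._≟_} (allFin⁺ (suc n)) (∈-allFin j₀) (λ j → f (insert zero j (remove zero ρ))) ⟩
  f (insert zero j₀ (remove zero ρ))
    ≈⟨ f-resp (Perm.insert-remove zero ρ) ⟩
  f ρ  ∎
  where
  j₀ = ρ ⟨$⟩ʳ zero
  F : Permutation (suc n) (suc n) → ℝ
  F π = indicator (π ≟ₚ ρ) * f π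
  split : ∀ j π → F (insert zero j π) ≈
          indicator (j Fin.≟ j₀) * (indicator (π ≟ₚ remove zero ρ) * f (insert zero j π))
  split j π = begin
    indicator (insert zero j π ≟ₚ ρ) * f (insert zero j π)
      ≈⟨ *-congʳ (f (insert zero j π)) (≈-reflexive
           (indicator-⇔ (insert zero j π ≟ₚ ρ) ((j Fin.≟ j₀) ×-dec (π ≟ₚ remove zero ρ))
             (insert-≈⁻ j π ρ) (uncurry (insert-≈⁺ j π ρ)))) ⟩
    indicator ((j Fin.≟ j₀) ×-dec (π ≟ₚ remove zero ρ)) * f (insert zero j π)
      ≈⟨ *-congʳ (f (insert zero j π)) (indicator-× (j Fin.≟ j₀) (π ≟ₚ remove zero ρ)) ⟩
    (indicator (j Fin.≟ j₀) * indicator (π ≟ₚ remove zero ρ)) * f (insert zero j π)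
      ≈⟨ *-assoc (indicator (j Fin.≟ j₀)) _ _ ⟩
    indicator (j Fin.≟ j₀) * (indicator (π ≟ₚ remove zero ρ) * f (insert zero j π))  ∎

∑-tuples : (xs : List A) (k : ℕ) (f : Vec A (suc k) → ℝ) →
           ∑ (tuples xs (suc k)) f ≈ ∑ xs (λ x → ∑ (tuples xs k) (λ v → f (x ∷ v)))
∑-tuples xs k f = ≈-trans
  (∑-concatMap (λ x → List.map (x ∷_) (tuples xs k)) xs f)
  (∑-cong xs (λ x → ≈-reflexive (∑-map (x ∷_) (tuples xs k) f)))

∑-tuples-indicator : (_≟_ : DecidableEquality A) {xs : List A} → Unique xs →
                     ∀ {k} (v : Vec A k) → (∀ i → lookup v i ∈ xs) → (f : Vec A k → ℝ) →
                     ∑ (tuples xs k) (λ u → indicator (Vec.≡-dec _≟_ u v) * f u) ≈ f v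
∑-tuples-indicator _≟_ xs! [] v∈ f = ≈-trans (+-identityʳ _) (*-identityˡ (f []))
∑-tuples-indicator _≟_ {xs} xs! {suc k} (y ∷ v) v∈ f = begin
  ∑ (tuples xs (suc k)) (λ u → indicator (Vec.≡-dec _≟_ u (y ∷ v)) * f u)
    ≈⟨ ∑-tuples xs k (λ u → indicator (Vec.≡-dec _≟_ u (y ∷ v)) * f u) ⟩
  ∑ xs (λ x → ∑ (tuples xs k) (λ u → indicator (Vec.≡-dec _≟_ (x ∷ u) (y ∷ v)) * f (x ∷ u)))
    ≈⟨ ∑-cong xs (λ x → ∑-cong (tuples xs k) (split x)) ⟩
  ∑ xs (λ x → ∑ (tuples xs k) (λ u → indicator (x ≟ y) * (indicator (Vec.≡-dec _≟_ u v) * f (x ∷ u))))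
    ≈⟨ ∑-cong xs (λ x → ∑-*ˡ (tuples xs k) (indicator (x ≟ y))
         (λ u → indicator (Vec.≡-dec _≟_ u v) * f (x ∷ u))) ⟩
  ∑ xs (λ x → indicator (x ≟ y) * ∑ (tuples xs k) (λ u → indicator (Vec.≡-dec _≟_ u v) * f (x ∷ u)))
    ≈⟨ ∑-cong xs (λ x → *-congˡ (indicator (x ≟ y))
         (∑-tuples-indicator _≟_ xs! v (v∈ ∘ suc) (λ u → f (x ∷ u)))) ⟩
  ∑ xs (λ x → indicator (x ≟ y) * f (x ∷ v))
    ≈⟨ ∑-indicator {_≟_ = _≟_} xs! (v∈ zero) (λ x → f (x ∷ v)) ⟩
  f (y ∷ v)  ∎
  where
  split : ∀ x u → indicator (Vec.≡-dec _≟_ (x ∷ u) (y ∷ v)) * f (x ∷ u) ≈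
                  indicator (x ≟ y) * (indicator (Vec.≡-dec _≟_ u v) * f (x ∷ u))
  split x u = begin
    indicator (Vec.≡-dec _≟_ (x ∷ u) (y ∷ v)) * f (x ∷ u)
      ≈⟨ *-congʳ (f (x ∷ u)) (≈-reflexive
           (indicator-⇔ (Vec.≡-dec _≟_ (x ∷ u) (y ∷ v)) ((x ≟ y) ×-dec Vec.≡-dec _≟_ u v)
             Vec.∷-injective (uncurry (cong₂ _∷_)))) ⟩
    indicator ((x ≟ y) ×-dec Vec.≡-dec _≟_ u v) * f (x ∷ u)
      ≈⟨ *-congʳ (f (x ∷ u)) (indicator-× (x ≟ y) (Vec.≡-dec _≟_ u v)) ⟩
    (indicator (x ≟ y) * indicator (Vec.≡-dec _≟_ u v)) * f (x ∷ u)
      ≈⟨ *-assoc (indicator (x ≟ y)) _ _ ⟩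
    indicator (x ≟ y) * (indicator (Vec.≡-dec _≟_ u v) * f (x ∷ u))  ∎

-- Counting words and the permutations to which they standardize.

words : ∀ a n → List (Vec (Fin a) n)
words a n = tuples (allFin a) n

_≟ᵇ_ : ∀ {a} → DecidableEquality (Vec ℕ a)
_≟ᵇ_ = Vec.≡-dec ℕ._≟_

_≟ʷ_ : ∀ {a n} → DecidableEquality (Vec (Fin a) n)
_≟ʷ_ = Vec.≡-dec Fin._≟_

inverseDescents-resp : ∀ {a n} (b : Vec ℕ a) {π σ : Permutation n n} → π Perm.≈ σ →
                       InverseDescentsWithin b π → InverseDescentsWithin b σ
inverseDescents-resp b {π} {σ} π≈σ within j (inj₁ j-last) = within j (inj₁ j-last)
inverseDescents-resp b {π} {σ} π≈σ within j (inj₂ (j′ , j′≡1+j , desc)) =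
  within j (inj₂ (j′ , j′≡1+j , subst₂ Fin._<_ (from-≡ j′) (from-≡ j) desc))
  where
  from-≡ : ∀ i → σ ⟨$⟩ˡ i ≡ π ⟨$⟩ˡ i
  from-≡ i = ≡.trans (cong (σ ⟨$⟩ˡ_) (≡.trans (≡.sym (Perm.inverseʳ π)) (π≈σ (π ⟨$⟩ˡ i)))) (Perm.inverseˡ σ)

-- Bijectivity as a count of preimages: exactly one word when the descent condition holds, none when
-- it fails. The decision is an argument so that matching on it evaluates the indicator on the
-- right.
∑-standardization-preimages : ∀ {a n} (b : Vec ℕ a) → Vec.sum b ≡ n → (π : Permutation n n) →
  (within? : Dec (InverseDescentsWithin b π)) →
  ∑ (words a n) (λ w → indicator (content w ≟ᵇ b) * indicator (π ≟ₚ standardization w))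
    ≈ indicator within?
∑-standardization-preimages {a} {n} b sum-b π (yes within)
  with (w₀ , w₀~b , w₀≈π) ← standardization-surjective n b π sum-b (inverseDescents⇒separated b π within) =
  begin
    ∑ (words a n) (λ w → indicator (content w ≟ᵇ b) * indicator (π ≟ₚ standardization w))
      ≈⟨ ∑-cong (words a n) (λ w → ≈-trans
           (≈-sym (indicator-× (content w ≟ᵇ b) (π ≟ₚ standardization w)))
           (≈-trans (≈-reflexive (indicator-⇔ ((content w ≟ᵇ b) ×-dec (π ≟ₚ standardization w)) (w ≟ʷ w₀)
             (λ (w~b , π≈w) → standardization-injective w w₀ (≡.trans w~b (≡.sym w₀~b))
                                (λ x → ≡.trans (≡.sym (π≈w x)) (≡.sym (w₀≈π x))))
             (λ { ≡.refl → w₀~b , ≡.sym ∘ w₀≈π })))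
           (≈-sym (*-identityʳ (indicator (w ≟ʷ w₀)))))) ⟩
    ∑ (words a n) (λ w → indicator (w ≟ʷ w₀) * 1ℝ)
      ≈⟨ ∑-tuples-indicator Fin._≟_ (allFin⁺ a) w₀ (λ i → ∈-allFin (lookup w₀ i)) (λ _ → 1ℝ) ⟩
    1ℝ  ∎
∑-standardization-preimages {a} {n} b sum-b π (no ¬within) = begin
    ∑ (words a n) (λ w → indicator (content w ≟ᵇ b) * indicator (π ≟ₚ standardization w))
      ≈⟨ ∑-cong (words a n) (λ w → ≈-trans
           (≈-sym (indicator-× (content w ≟ᵇ b) (π ≟ₚ standardization w)))
           (≈-reflexive (indicator-false ((content w ≟ᵇ b) ×-dec (π ≟ₚ standardization w))
             (λ { (≡.refl , π≈w) → ¬within (inverseDescents-resp (content w) {standardization w} {π}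
                    (≡.sym ∘ π≈w) (standardization-inverseDescents w)) })))) ⟩
    ∑ (words a n) (λ _ → 0ℝ)   ≈⟨ ∑-zero (words a n) ⟩
    0ℝ                         ∎

-- Change of variables along the bijection: write the descent indicator as a preimage count,
-- exchange the sums, and let each word select its own standardization.
∑-inverseDescents : ∀ {a n} (b : Vec ℕ a) → Vec.sum b ≡ n → (f : Permutation n n → ℝ) → RespectsPerm f →
  ∑ (permutations n) (λ π → indicator (inverseDescentsWithin? b π) * f π)
    ≈ ∑ (words a n) (λ w → indicator (content w ≟ᵇ b) * f (standardization w))
∑-inverseDescents {a} {n} b sum-b f f-resp = begin
  ∑ (permutations n) (λ π → indicator (inverseDescentsWithin? b π) * f π)
    ≈⟨ ∑-cong (permutations n) (λ π → *-congʳ (f π) (∑-standardization-preimages b sum-b π (inverseDescentsWithin? b π))) ⟨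
  ∑ (permutations n) (λ π → ∑ (words a n) (λ w → has-b w * sorts-to w π) * f π)
    ≈⟨ ∑-cong (permutations n) (λ π → ∑-*ʳ (words a n) (f π) (λ w → has-b w * sorts-to w π)) ⟨
  ∑ (permutations n) (λ π → ∑ (words a n) (λ w → (has-b w * sorts-to w π) * f π))
    ≈⟨ ∑-swap (permutations n) (words a n) (λ π w → (has-b w * sorts-to w π) * f π) ⟩
  ∑ (words a n) (λ w → ∑ (permutations n) (λ π → (has-b w * sorts-to w π) * f π))
    ≈⟨ ∑-cong (words a n) (λ w → ∑-cong (permutations n) (λ π → *-assoc (has-b w) (sorts-to w π) (f π))) ⟩
  ∑ (words a n) (λ w → ∑ (permutations n) (λ π → has-b w * (sorts-to w π * f π)))
    ≈⟨ ∑-cong (words a n) (λ w → ∑-*ˡ (permutations n) (has-b w) (λ π → sorts-to w π * f π)) ⟩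
  ∑ (words a n) (λ w → has-b w * ∑ (permutations n) (λ π → sorts-to w π * f π))
    ≈⟨ ∑-cong (words a n) (λ w → *-congˡ (has-b w) (∑-permutations n (standardization w) f f-resp)) ⟩
  ∑ (words a n) (λ w → has-b w * f (standardization w))  ∎
  where
  has-b : Vec (Fin a) n → ℝ
  has-b w = indicator (content w ≟ᵇ b)
  sorts-to : Vec (Fin a) n → Permutation n n → ℝ
  sorts-to w π = indicator (π ≟ₚ standardization w)

∑-lookup : ∀ {a} (b : Vec ℕ a) → ∑ (allFin a) (λ c → fromℕ (lookup b c)) ≈ fromℕ (Vec.sum b)
∑-lookup []      = ≈-refl
∑-lookup {suc a} (k ∷ b) = begin
  ∑ (allFin (suc a)) (λ c → fromℕ (lookup (k ∷ b) c))      ≈⟨ ∑-allFin a (λ c → fromℕ (lookup (k ∷ b) c)) ⟩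
  fromℕ k + ∑ (allFin a) (λ c → fromℕ (lookup b c))        ≈⟨ +-cong ≈-refl (∑-lookup b) ⟩
  fromℕ k + fromℕ (Vec.sum b)                              ≈⟨ fromℕ-+ k (Vec.sum b) ⟨
  fromℕ (k ℕ.+ Vec.sum b)                                  ∎

-- The multinomial count of words, kept free of division. Words that start with `c` are counted by
-- `b` with its entry at `c` decreased; the factorial freed by this is that entry, so `c`
-- contributes `lookup b c` times `n !`, and these entries add up to `suc n`. A zero entry makes
-- both sides vanish.
factorials-*-words : ∀ {a} n (b : Vec ℕ a) → Vec.sum b ≡ n →
  fromℕ (factorials b) * ∑ (words a n) (λ w → indicator (content w ≟ᵇ b)) ≈ fromℕ (n !)
factorials-*-words {a} zero b sum-b with ≡.refl ← sum≡0⇒replicate-0 b sum-b = begin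
  fromℕ (factorials (Vec.replicate a 0)) * (indicator (Vec.replicate a 0 ≟ᵇ Vec.replicate a 0) + 0ℝ)
    ≈⟨ *-cong (≈-reflexive (cong fromℕ (factorials-replicate a)))
              (≈-trans (+-identityʳ _)
                (≈-reflexive (indicator-true (Vec.replicate a 0 ≟ᵇ Vec.replicate a 0) ≡.refl))) ⟩
  1ℝ * 1ℝ   ≈⟨ *-identityˡ 1ℝ ⟩
  1ℝ        ∎
  where
  factorials-replicate : ∀ a → factorials (Vec.replicate a 0) ≡ 1
  factorials-replicate zero    = ≡.refl
  factorials-replicate (suc a) = ≡.trans (ℕ.*-identityˡ _) (factorials-replicate a)
factorials-*-words {a} (suc n) b sum-b = begin
  fromℕ (factorials b) * ∑ (words a (suc n)) (λ w → indicator (content w ≟ᵇ b))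
    ≈⟨ *-congˡ (fromℕ (factorials b)) (∑-tuples (allFin a) n (λ w → indicator (content w ≟ᵇ b))) ⟩
  fromℕ (factorials b) * ∑ (allFin a) (λ c → ∑ (words a n) (λ w → indicator (content (c ∷ w) ≟ᵇ b)))
    ≈⟨ ∑-*ˡ (allFin a) (fromℕ (factorials b)) (λ c → ∑ (words a n) (λ w → indicator (content (c ∷ w) ≟ᵇ b))) ⟨
  ∑ (allFin a) (λ c → fromℕ (factorials b) * ∑ (words a n) (λ w → indicator (content (c ∷ w) ≟ᵇ b)))
    ≈⟨ ∑-cong (allFin a) first-letter ⟩
  ∑ (allFin a) (λ c → fromℕ (lookup b c) * fromℕ (n !))
    ≈⟨ ∑-*ʳ (allFin a) (fromℕ (n !)) (λ c → fromℕ (lookup b c)) ⟩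
  ∑ (allFin a) (λ c → fromℕ (lookup b c)) * fromℕ (n !)
    ≈⟨ *-congʳ (fromℕ (n !)) (≈-trans (∑-lookup b) (≈-reflexive (cong fromℕ sum-b))) ⟩
  fromℕ (suc n) * fromℕ (n !)
    ≈⟨ fromℕ-* (suc n) (n !) ⟨
  fromℕ (suc n !)  ∎
  where
  first-letter : ∀ c → fromℕ (factorials b) * ∑ (words a n) (λ w → indicator (content (c ∷ w) ≟ᵇ b))
                       ≈ fromℕ (lookup b c) * fromℕ (n !)
  first-letter c with decrement b c
  ... | inj₁ bc≡0 = begin
    fromℕ (factorials b) * ∑ (words a n) (λ w → indicator (content (c ∷ w) ≟ᵇ b))
      ≈⟨ *-congˡ (fromℕ (factorials b)) (≈-trans
           (∑-cong (words a n) (λ w → ≈-reflexive (indicator-false (content (c ∷ w) ≟ᵇ b) (c-occurs w))))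
           (∑-zero (words a n))) ⟩
    fromℕ (factorials b) * 0ℝ           ≈⟨ zeroʳ _ ⟩
    0ℝ                                  ≈⟨ zeroˡ _ ⟨
    fromℕ 0 * fromℕ (n !)               ≡⟨ cong (λ k → fromℕ k * fromℕ (n !)) bc≡0 ⟨
    fromℕ (lookup b c) * fromℕ (n !)    ∎
    where
    c-occurs : ∀ w → content (c ∷ w) ≢ b
    c-occurs w eq = ℕ.0≢1+n (≡.trans (≡.sym bc≡0)
      (≡.trans (cong (λ b → lookup b c) (≡.sym eq)) (Vec.lookup∘updateAt c (content w))))
  ... | inj₂ (b′ , ≡.refl) = begin
    fromℕ (factorials b) * ∑ (words a n) (λ w → indicator (content (c ∷ w) ≟ᵇ b))
      ≈⟨ *-cong (≈-trans (≈-reflexive (cong fromℕ (factorials-updateAt b′ c)))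
                         (fromℕ-* (suc (lookup b′ c)) (factorials b′)))
                (∑-cong (words a n) (λ w → ≈-reflexive
                  (indicator-⇔ (content (c ∷ w) ≟ᵇ b) (content w ≟ᵇ b′)
                    (updateAt-suc-injective (content w) b′ c) (cong (_[ c ]%= suc))))) ⟩
    (fromℕ (suc (lookup b′ c)) * fromℕ (factorials b′)) * ∑ (words a n) (λ w → indicator (content w ≟ᵇ b′))
      ≈⟨ *-assoc (fromℕ (suc (lookup b′ c))) (fromℕ (factorials b′)) _ ⟩
    fromℕ (suc (lookup b′ c)) * (fromℕ (factorials b′) * ∑ (words a n) (λ w → indicator (content w ≟ᵇ b′)))
      ≈⟨ *-cong (≈-reflexive (cong fromℕ (≡.sym (Vec.lookup∘updateAt c b′))))
                (factorials-*-words n b′ (ℕ.suc-injective (≡.trans (≡.sym (sum-updateAt b′ c)) sum-b))) ⟩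
    fromℕ (lookup b c) * fromℕ (n !)  ∎

-- The admissible permutations are equinumerous with the words of content `b`, so their number is
-- the multinomial coefficient and the two factors of the measure cancel.
multinomial-*-reciprocal : ∀ {a n} (b : Vec ℕ a) → Vec.sum b ≡ n →
  fromℕ (multinomial b) * reciprocal (List.length (List.filter (inverseDescentsWithin? b) (permutations n))) ≈ 1ℝ
multinomial-*-reciprocal {a} {n} b ≡.refl =
  ≈-trans (*-congʳ (reciprocal L) (≈-reflexive (cong fromℕ multinomial≡L))) (fromℕ-*-reciprocal L L≢0)
  where
  L = List.length (List.filter (inverseDescentsWithin? b) (permutations n))
  F*L : factorials b ℕ.* L ≡ n !
  F*L = fromℕ-injective (begin
    fromℕ (factorials b ℕ.* L)         ≈⟨ fromℕ-* (factorials b) L ⟩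
    fromℕ (factorials b) * fromℕ L     ≈⟨ *-congˡ (fromℕ (factorials b)) L≈ ⟩
    fromℕ (factorials b) * ∑ (words a n) (λ w → indicator (content w ≟ᵇ b))   ≈⟨ factorials-*-words n b ≡.refl ⟩
    fromℕ (n !)                        ∎)
    where
    L≈ : fromℕ L ≈ ∑ (words a n) (λ w → indicator (content w ≟ᵇ b))
    L≈ = begin
      fromℕ L
        ≈⟨ fromℕ-length-filter (inverseDescentsWithin? b) (permutations n) ⟩
      ∑ (permutations n) (λ π → indicator (inverseDescentsWithin? b π))
        ≈⟨ ∑-cong (permutations n) (λ π → *-identityʳ (indicator (inverseDescentsWithin? b π))) ⟨
      ∑ (permutations n) (λ π → indicator (inverseDescentsWithin? b π) * 1ℝ)
        ≈⟨ ∑-inverseDescents b ≡.refl (λ _ → 1ℝ) (λ _ → ≈-refl) ⟩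
      ∑ (words a n) (λ w → indicator (content w ≟ᵇ b) * 1ℝ)
        ≈⟨ ∑-cong (words a n) (λ w → *-identityʳ (indicator (content w ≟ᵇ b))) ⟩
      ∑ (words a n) (λ w → indicator (content w ≟ᵇ b))  ∎
  n!≢0 : n ! ≢ 0
  n!≢0 = ℕ.≢-nonZero⁻¹ (n !) {{n ℕ.!≢0}}
  -- Rules out the default value of `reciprocal` at zero: the count divides the nonzero `n !`.
  L≢0 : L ≢ 0
  L≢0 L≡0 = n!≢0 (≡.trans (≡.sym F*L)
    (≡.trans (cong (factorials b ℕ.*_) L≡0) (ℕ.*-zeroʳ (factorials b))))
  instance
    factorials≢0 : ℕ.NonZero (factorials b)
    factorials≢0 = ℕ.≢-nonZero λ F≡0 → n!≢0 (≡.trans (≡.sym F*L) (cong (ℕ._* L) F≡0))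
  multinomial≡L : multinomial b ≡ L
  multinomial≡L = ≡.trans (ℕ./-congˡ (≡.trans (≡.sym F*L) (ℕ.*-comm (factorials b) L)))
                          (ℕ.m*n/n≡m L (factorials b))

-- The shuffle as the law of a standardized random word.

weight : ∀ {a n} → Vector ℝ a → Vec (Fin a) n → ℝ
weight p w = product (λ i → p (lookup w i))

monomial : ∀ {a} → Vector ℝ a → Vec ℕ a → ℝ
monomial p b = product (λ i → p i ^ lookup b i)

monomial-replicate-0 : ∀ {a} (p : Vector ℝ a) → monomial p (Vec.replicate a 0) ≈ 1ℝ
monomial-replicate-0 {zero}  p = ≈-refl
monomial-replicate-0 {suc a} p = ≈-trans (*-identityˡ _) (monomial-replicate-0 (p ∘ suc))

monomial-updateAt : ∀ {a} (p : Vector ℝ a) (b : Vec ℕ a) c →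
                    monomial p (b [ c ]%= suc) ≈ p c * monomial p b
monomial-updateAt p (k ∷ b) zero    = *-assoc (p zero) (p zero ^ k) (monomial (p ∘ suc) b)
monomial-updateAt p (k ∷ b) (suc c) = begin
  p zero ^ k * monomial (p ∘ suc) (b [ c ]%= suc)       ≈⟨ *-congˡ (p zero ^ k) (monomial-updateAt (p ∘ suc) b c) ⟩
  p zero ^ k * (p (suc c) * monomial (p ∘ suc) b)       ≈⟨ *-leftComm (p zero ^ k) (p (suc c)) (monomial (p ∘ suc) b) ⟩
  p (suc c) * (p zero ^ k * monomial (p ∘ suc) b)       ∎

monomial-content : ∀ {a n} (p : Vector ℝ a) (w : Vec (Fin a) n) → monomial p (content w) ≈ weight p w
monomial-content p []      = monomial-replicate-0 p
monomial-content p (c ∷ w) = ≈-trans (monomial-updateAt p (content w) c) (*-congˡ (p c) (monomial-content p w))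

lookup≤sum : ∀ {a} (b : Vec ℕ a) c → lookup b c ℕ.≤ Vec.sum b
lookup≤sum (k ∷ b) zero    = ℕ.m≤m+n k (Vec.sum b)
lookup≤sum (k ∷ b) (suc c) = ℕ.≤-trans (lookup≤sum b c) (ℕ.m≤n+m (Vec.sum b) k)

-- Takes real observables such as `sgn`; at `fromℕ ∘ X` it is `expectation P X` by definition.
𝔼 : ∀ {n} → Measure n → (Permutation n n → ℝ) → ℝ
𝔼 {n} P f = ∑ (permutations n) (λ π → P π * f π)

-- After cancellation, each word of content `b` carries the weight `monomial p b`. Every word has
-- exactly one content, so summing over all compositions restores the sum over all words, each
-- weighted by the product of its letter probabilities.
𝔼-biasedShuffle : ∀ {n a} (p : Vector ℝ a) (f : Permutation n n → ℝ) → RespectsPerm f →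
                  𝔼 (biasedShuffle n p) f ≈ ∑ (words a n) (λ w → weight p w * f (standardization w))
𝔼-biasedShuffle {n} {a} p f f-resp = begin
  ∑ (permutations n) (λ π → ∑ (weakCompositions n a) (λ b → law b π) * f π)
    ≈⟨ ∑-cong (permutations n) (λ π → ∑-*ʳ (weakCompositions n a) (f π) (λ b → law b π)) ⟨
  ∑ (permutations n) (λ π → ∑ (weakCompositions n a) (λ b → law b π * f π))
    ≈⟨ ∑-swap (permutations n) (weakCompositions n a) (λ π b → law b π * f π) ⟩
  ∑ (weakCompositions n a) (λ b → ∑ (permutations n) (λ π → law b π * f π))
    ≈⟨ ∑-filter (λ b → Vec.sum b ℕ.≟ n) (tuples (upTo (suc n)) a) (λ b → ∑ (permutations n) (λ π → law b π * f π)) ⟩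
  ∑ (tuples (upTo (suc n)) a) (λ b → indicator (Vec.sum b ℕ.≟ n) * ∑ (permutations n) (λ π → law b π * f π))
    ≈⟨ ∑-cong (tuples (upTo (suc n)) a) (λ b → given-composition b (Vec.sum b ℕ.≟ n)) ⟩
  ∑ (tuples (upTo (suc n)) a) (λ b → ∑ (words a n) (λ w → indicator (b ≟ᵇ content w) * F b w))
    ≈⟨ ∑-swap (tuples (upTo (suc n)) a) (words a n) (λ b w → indicator (b ≟ᵇ content w) * F b w) ⟩
  ∑ (words a n) (λ w → ∑ (tuples (upTo (suc n)) a) (λ b → indicator (b ≟ᵇ content w) * F b w))
    -- The content of a word of length `n` has entries at most `n`, hence occurs among the tuples
    -- over `upTo (suc n)`.
    ≈⟨ ∑-cong (words a n) (λ w → ∑-tuples-indicator ℕ._≟_ (upTo⁺ (suc n)) (content w)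
         (λ i → ∈-upTo⁺ (s≤s (ℕ.≤-trans (lookup≤sum (content w) i) (ℕ.≤-reflexive (sum-content w)))))
         (λ b → F b w)) ⟩
  ∑ (words a n) (λ w → monomial p (content w) * f (standardization w))
    ≈⟨ ∑-cong (words a n) (λ w → *-congʳ (f (standardization w)) (monomial-content p w)) ⟩
  ∑ (words a n) (λ w → weight p w * f (standardization w))  ∎
  where
  size : Vec ℕ a → ℝ
  size b = reciprocal (List.length (List.filter (inverseDescentsWithin? b) (permutations n)))
  within : Vec ℕ a → Permutation n n → ℝ
  within b π = indicator (inverseDescentsWithin? b π)
  law : Vec ℕ a → Permutation n n → ℝ
  law b π = (fromℕ (multinomial b) * monomial p b) * (within b π * size b)
  F : Vec ℕ a → Vec (Fin a) n → ℝ
  F b w = monomial p b * f (standardization w)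

  rearrange : ∀ m x i r y → ((m * x) * (i * r)) * y ≈ (x * (m * r)) * (i * y)
  rearrange m x i r y = pointwise⇒≈ λ k →
    solve 5 (λ m x i r y → ((m :* x) :* (i :* r)) :* y := (x :* (m :* r)) :* (i :* y)) ≡.refl
      (seq m k) (seq x k) (seq i k) (seq r k) (seq y k)
    where open +-*-Solver

  given-composition : ∀ b → (sum? : Dec (Vec.sum b ≡ n)) →
    indicator sum? * ∑ (permutations n) (λ π → law b π * f π)
      ≈ ∑ (words a n) (λ w → indicator (b ≟ᵇ content w) * F b w)
  given-composition b (no sum-b≢n) = begin
    0ℝ * ∑ (permutations n) (λ π → law b π * f π)   ≈⟨ zeroˡ _ ⟩
    0ℝ                                              ≈⟨ ∑-zero (words a n) ⟨
    ∑ (words a n) (λ _ → 0ℝ)                        ≈⟨ ∑-cong (words a n) (λ w → ≈-trans (*-congʳ (F b w)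
      (≈-reflexive (indicator-false (b ≟ᵇ content w) (λ { ≡.refl → sum-b≢n (sum-content w) })))) (zeroˡ (F b w))) ⟨
    ∑ (words a n) (λ w → indicator (b ≟ᵇ content w) * F b w)  ∎
  given-composition b (yes sum-b) = begin
    1ℝ * ∑ (permutations n) (λ π → law b π * f π)
      ≈⟨ *-identityˡ _ ⟩
    ∑ (permutations n) (λ π → law b π * f π)
      ≈⟨ ∑-cong (permutations n) (λ π → rearrange (fromℕ (multinomial b)) (monomial p b) (within b π) (size b) (f π)) ⟩
    ∑ (permutations n) (λ π → (monomial p b * (fromℕ (multinomial b) * size b)) * (within b π * f π))
      ≈⟨ ∑-*ˡ (permutations n) (monomial p b * (fromℕ (multinomial b) * size b)) (λ π → within b π * f π) ⟩
    (monomial p b * (fromℕ (multinomial b) * size b)) * ∑ (permutations n) (λ π → within b π * f π)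
      ≈⟨ *-cong (≈-trans (*-congˡ (monomial p b) (multinomial-*-reciprocal b sum-b)) (*-identityʳ (monomial p b)))
                (∑-inverseDescents b sum-b f f-resp) ⟩
    monomial p b * ∑ (words a n) (λ w → indicator (content w ≟ᵇ b) * f (standardization w))
      ≈⟨ ∑-*ˡ (words a n) (monomial p b) (λ w → indicator (content w ≟ᵇ b) * f (standardization w)) ⟨
    ∑ (words a n) (λ w → monomial p b * (indicator (content w ≟ᵇ b) * f (standardization w)))
      ≈⟨ ∑-cong (words a n) (λ w → ≈-trans
           (*-leftComm (monomial p b) (indicator (content w ≟ᵇ b)) (f (standardization w)))
           (*-congʳ (F b w) (≈-reflexive (indicator-⇔ (content w ≟ᵇ b) (b ≟ᵇ content w) ≡.sym ≡.sym)))) ⟩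
    ∑ (words a n) (λ w → indicator (b ≟ᵇ content w) * F b w)  ∎

-- Marginals of a word of independent letters.

∑-words-mass : ∀ {a} n (p : Vector ℝ a) → sum p ≈ 1ℝ → ∑ (words a n) (weight p) ≈ 1ℝ
∑-words-mass zero p ∑p≈1 = +-identityʳ 1ℝ
∑-words-mass {a} (suc n) p ∑p≈1 = begin
  ∑ (words a (suc n)) (weight p)
    ≈⟨ ∑-tuples (allFin a) n (weight p) ⟩
  ∑ (allFin a) (λ c → ∑ (words a n) (λ w → p c * weight p w))
    ≈⟨ ∑-cong (allFin a) (λ c → ≈-trans (∑-*ˡ (words a n) (p c) (weight p))
         (≈-trans (*-congˡ (p c) (∑-words-mass n p ∑p≈1)) (*-identityʳ (p c)))) ⟩
  ∑ (allFin a) p   ≈⟨ ∑-allFin-sum a p ⟩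
  sum p            ≈⟨ ∑p≈1 ⟩
  1ℝ               ∎

∑-words-lookup : ∀ {a} n (p : Vector ℝ a) → sum p ≈ 1ℝ → (g : Fin a → ℝ) (x : Fin n) →
                 ∑ (words a n) (λ w → weight p w * g (lookup w x)) ≈ ∑ (allFin a) (λ c → p c * g c)
∑-words-lookup {a} (suc n) p ∑p≈1 g zero = begin
  ∑ (words a (suc n)) (λ w → weight p w * g (lookup w zero))
    ≈⟨ ∑-tuples (allFin a) n (λ w → weight p w * g (lookup w zero)) ⟩
  ∑ (allFin a) (λ c → ∑ (words a n) (λ w → (p c * weight p w) * g c))
    ≈⟨ ∑-cong (allFin a) (λ c → ≈-trans (∑-*ʳ (words a n) (g c) (λ w → p c * weight p w))
         (*-congʳ (g c) (≈-trans (∑-*ˡ (words a n) (p c) (weight p))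
           (≈-trans (*-congˡ (p c) (∑-words-mass n p ∑p≈1)) (*-identityʳ (p c)))))) ⟩
  ∑ (allFin a) (λ c → p c * g c)  ∎
∑-words-lookup {a} (suc n) p ∑p≈1 g (suc x) = begin
  ∑ (words a (suc n)) (λ w → weight p w * g (lookup w (suc x)))
    ≈⟨ ∑-tuples (allFin a) n (λ w → weight p w * g (lookup w (suc x))) ⟩
  ∑ (allFin a) (λ c → ∑ (words a n) (λ w → (p c * weight p w) * g (lookup w x)))
    ≈⟨ ∑-cong (allFin a) (λ c → ≈-trans
         (∑-cong (words a n) (λ w → *-assoc (p c) (weight p w) (g (lookup w x))))
         (≈-trans (∑-*ˡ (words a n) (p c) (λ w → weight p w * g (lookup w x)))
           (*-congˡ (p c) (∑-words-lookup n p ∑p≈1 g x)))) ⟩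
  ∑ (allFin a) (λ c → p c * G)    ≈⟨ ∑-*ʳ (allFin a) G p ⟩
  ∑ (allFin a) p * G              ≈⟨ *-congʳ G (≈-trans (∑-allFin-sum a p) ∑p≈1) ⟩
  1ℝ * G                          ≈⟨ *-identityˡ G ⟩
  G                               ∎
  where G = ∑ (allFin a) (λ c → p c * g c)

-- Letters before `x` are peeled off, each contributing total mass one; once the letter at `x` is
-- fixed, the one-letter marginal handles `y`.
∑-words-lookup₂ : ∀ {a} n (p : Vector ℝ a) → sum p ≈ 1ℝ → (h : Fin a → Fin a → ℝ) {x y : Fin n} → x Fin.< y →
                  ∑ (words a n) (λ w → weight p w * h (lookup w x) (lookup w y))
                    ≈ ∑ (allFin a) (λ c → p c * ∑ (allFin a) (λ d → p d * h c d))
∑-words-lookup₂ {a} (suc n) p ∑p≈1 h {zero} {suc y} _ = begin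
  ∑ (words a (suc n)) (λ w → weight p w * h (lookup w zero) (lookup w (suc y)))
    ≈⟨ ∑-tuples (allFin a) n (λ w → weight p w * h (lookup w zero) (lookup w (suc y))) ⟩
  ∑ (allFin a) (λ c → ∑ (words a n) (λ w → (p c * weight p w) * h c (lookup w y)))
    ≈⟨ ∑-cong (allFin a) (λ c → ≈-trans
         (∑-cong (words a n) (λ w → *-assoc (p c) (weight p w) (h c (lookup w y))))
         (≈-trans (∑-*ˡ (words a n) (p c) (λ w → weight p w * h c (lookup w y)))
           (*-congˡ (p c) (∑-words-lookup n p ∑p≈1 (h c) y)))) ⟩
  ∑ (allFin a) (λ c → p c * ∑ (allFin a) (λ d → p d * h c d))  ∎
∑-words-lookup₂ {a} (suc n) p ∑p≈1 h {suc x} {suc y} (s≤s x<y) = begin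
  ∑ (words a (suc n)) (λ w → weight p w * h (lookup w (suc x)) (lookup w (suc y)))
    ≈⟨ ∑-tuples (allFin a) n (λ w → weight p w * h (lookup w (suc x)) (lookup w (suc y))) ⟩
  ∑ (allFin a) (λ c → ∑ (words a n) (λ w → (p c * weight p w) * h (lookup w x) (lookup w y)))
    ≈⟨ ∑-cong (allFin a) (λ c → ≈-trans
         (∑-cong (words a n) (λ w → *-assoc (p c) (weight p w) (h (lookup w x) (lookup w y))))
         (≈-trans (∑-*ˡ (words a n) (p c) (λ w → weight p w * h (lookup w x) (lookup w y)))
           (*-congˡ (p c) (∑-words-lookup₂ n p ∑p≈1 h x<y)))) ⟩
  ∑ (allFin a) (λ c → p c * H)    ≈⟨ ∑-*ʳ (allFin a) H p ⟩
  ∑ (allFin a) p * H              ≈⟨ *-congʳ H (≈-trans (∑-allFin-sum a p) ∑p≈1) ⟩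
  1ℝ * H                          ≈⟨ *-identityˡ H ⟩
  H                               ∎
  where H = ∑ (allFin a) (λ c → p c * ∑ (allFin a) (λ d → p d * h c d))

-- The sign of a pair and its mean under one shuffle.

sgn : ∀ {n} → Fin n → Fin n → ℝ
sgn u v = indicator (u Fin.<? v) - indicator (v Fin.<? u)

sgn-< : ∀ {n} {u v : Fin n} → u Fin.< v → sgn u v ≈ 1ℝ
sgn-< {u = u} {v} u<v = begin
  indicator (u Fin.<? v) - indicator (v Fin.<? u)
    ≡⟨ cong₂ _-_ (indicator-true (u Fin.<? v) u<v) (indicator-false (v Fin.<? u) (ℕ.<-asym u<v)) ⟩
  1ℝ - 0ℝ   ≈⟨ pointwise⇒≈ (λ _ → ≡.refl) ⟩
  1ℝ        ∎

sgn-flip : ∀ {n} (u v : Fin n) → sgn u v ≈ - sgn v u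
sgn-flip u v = flip (indicator (u Fin.<? v)) (indicator (v Fin.<? u))
  where
  flip : ∀ x y → x - y ≈ - (y - x)
  flip x y = pointwise⇒≈ λ k → solve 2 (λ x y → x :- y := :- (y :- x)) ≡.refl (seq x k) (seq y k)
    where open +-*-Solver

sgn-> : ∀ {n} {u v : Fin n} → v Fin.< u → sgn u v ≈ - 1ℝ
sgn-> {u = u} {v} v<u = ≈-trans (sgn-flip u v) (-‿cong (sgn-< v<u))

sgn-≡ : ∀ {n} {u v : Fin n} → u ≡ v → sgn u v ≈ 0ℝ
sgn-≡ {u = u} ≡.refl = -‿inverseʳ (indicator (u Fin.<? u))

-- Ranks compare as letters do, except that stability puts equal letters in increasing order. There
-- the letter sign is 0 and the rank sign 1, which the tie indicator corrects.
standardization-sgn : ∀ {a n} (w : Vec (Fin a) n) {x y} → x Fin.< y →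
  sgn (standardization w ⟨$⟩ʳ x) (standardization w ⟨$⟩ʳ y)
    ≈ sgn (lookup w x) (lookup w y) + indicator (lookup w y Fin.≟ lookup w x)
standardization-sgn w {x} {y} x<y with Fin.<-cmp (lookup w x) (lookup w y)
... | tri< wx<wy wx≢wy _ = begin
  sgn (standardization w ⟨$⟩ʳ x) (standardization w ⟨$⟩ʳ y)   ≈⟨ sgn-< (standardization-< w wx<wy) ⟩
  1ℝ                                                          ≈⟨ +-identityʳ 1ℝ ⟨
  1ℝ + 0ℝ
    ≈⟨ +-cong (sgn-< wx<wy) (≈-reflexive (indicator-false (lookup w y Fin.≟ lookup w x) (wx≢wy ∘ ≡.sym))) ⟨
  sgn (lookup w x) (lookup w y) + indicator (lookup w y Fin.≟ lookup w x)  ∎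
... | tri≈ _ wx≡wy _ = begin
  sgn (standardization w ⟨$⟩ʳ x) (standardization w ⟨$⟩ʳ y)
    ≈⟨ sgn-< (standardization-stable w x<y (ℕ.≤-reflexive (cong toℕ wx≡wy))) ⟩
  1ℝ                                                          ≈⟨ +-identityˡ 1ℝ ⟨
  0ℝ + 1ℝ
    ≈⟨ +-cong (sgn-≡ wx≡wy) (≈-reflexive (indicator-true (lookup w y Fin.≟ lookup w x) (≡.sym wx≡wy))) ⟨
  sgn (lookup w x) (lookup w y) + indicator (lookup w y Fin.≟ lookup w x)  ∎
... | tri> _ wx≢wy wy<wx = begin
  sgn (standardization w ⟨$⟩ʳ x) (standardization w ⟨$⟩ʳ y)   ≈⟨ sgn-> (standardization-< w wy<wx) ⟩
  - 1ℝ                                                        ≈⟨ +-identityʳ (- 1ℝ) ⟨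
  - 1ℝ + 0ℝ
    ≈⟨ +-cong (sgn-> wy<wx) (≈-reflexive (indicator-false (lookup w y Fin.≟ lookup w x) (wx≢wy ∘ ≡.sym))) ⟨
  sgn (lookup w x) (lookup w y) + indicator (lookup w y Fin.≟ lookup w x)  ∎

-- The summand is `X c d - X d c`, so the double sum is that of `X` minus its transpose, and
-- exchanging the order of summation identifies the two.
∑∑-sgn : ∀ {a} (p : Vector ℝ a) → ∑ (allFin a) (λ c → ∑ (allFin a) (λ d → p c * (p d * sgn c d))) ≈ 0ℝ
∑∑-sgn {a} p = begin
  ∑ (allFin a) (λ c → ∑ (allFin a) (λ d → p c * (p d * sgn c d)))
    ≈⟨ ∑-cong (allFin a) (λ c → ≈-trans
         (∑-cong (allFin a) (λ d → expand (p c) (p d) (indicator (c Fin.<? d)) (indicator (d Fin.<? c))))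
         (∑-- (allFin a) (X c) (λ d → X d c))) ⟩
  ∑ (allFin a) (λ c → ∑ (allFin a) (X c) - ∑ (allFin a) (λ d → X d c))
    ≈⟨ ∑-- (allFin a) (λ c → ∑ (allFin a) (X c)) (λ c → ∑ (allFin a) (λ d → X d c)) ⟩
  ∑ (allFin a) (λ c → ∑ (allFin a) (X c)) - ∑ (allFin a) (λ c → ∑ (allFin a) (λ d → X d c))
    ≈⟨ +-cong (∑-swap (allFin a) (allFin a) X) ≈-refl ⟩
  ∑ (allFin a) (λ c → ∑ (allFin a) (λ d → X d c)) - ∑ (allFin a) (λ c → ∑ (allFin a) (λ d → X d c))
    ≈⟨ -‿inverseʳ _ ⟩
  0ℝ  ∎
  where
  X : Fin a → Fin a → ℝ
  X c d = p c * (p d * indicator (c Fin.<? d))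
  expand : ∀ x y i j → x * (y * (i - j)) ≈ x * (y * i) - y * (x * j)
  expand x y i j = pointwise⇒≈ λ k →
    solve 4 (λ x y i j → x :* (y :* (i :- j)) := x :* (y :* i) :- y :* (x :* j)) ≡.refl
      (seq x k) (seq y k) (seq i k) (seq j k)
    where open +-*-Solver

∑∑-standardization-sgn : ∀ {a} (p : Vector ℝ a) →
  ∑ (allFin a) (λ c → p c * ∑ (allFin a) (λ d → p d * (sgn c d + indicator (d Fin.≟ c)))) ≈ sum (λ i → p i ^ 2)
∑∑-standardization-sgn {a} p = begin
  ∑ (allFin a) (λ c → p c * ∑ (allFin a) (λ d → p d * (sgn c d + indicator (d Fin.≟ c))))
    ≈⟨ ∑-cong (allFin a) square ⟩
  ∑ (allFin a) (λ c → ∑ (allFin a) (λ d → p c * (p d * sgn c d)) + p c ^ 2)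
    ≈⟨ ∑-+ (allFin a) (λ c → ∑ (allFin a) (λ d → p c * (p d * sgn c d))) (λ c → p c ^ 2) ⟩
  ∑ (allFin a) (λ c → ∑ (allFin a) (λ d → p c * (p d * sgn c d))) + ∑ (allFin a) (λ c → p c ^ 2)
    ≈⟨ +-cong (∑∑-sgn p) (∑-allFin-sum a (λ c → p c ^ 2)) ⟩
  0ℝ + sum (λ i → p i ^ 2)
    ≈⟨ +-identityˡ _ ⟩
  sum (λ i → p i ^ 2)  ∎
  where
  expand : ∀ x s i → x * (s + i) ≈ x * s + i * x
  expand x s i = pointwise⇒≈ λ k →
    solve 3 (λ x s i → x :* (s :+ i) := x :* s :+ i :* x) ≡.refl (seq x k) (seq s k) (seq i k)
    where open +-*-Solver
  square : ∀ c → p c * ∑ (allFin a) (λ d → p d * (sgn c d + indicator (d Fin.≟ c)))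
                 ≈ ∑ (allFin a) (λ d → p c * (p d * sgn c d)) + p c ^ 2
  square c = begin
    p c * ∑ (allFin a) (λ d → p d * (sgn c d + indicator (d Fin.≟ c)))
      ≈⟨ *-congˡ (p c) (≈-trans
           (∑-cong (allFin a) (λ d → expand (p d) (sgn c d) (indicator (d Fin.≟ c))))
           (∑-+ (allFin a) (λ d → p d * sgn c d) (λ d → indicator (d Fin.≟ c) * p d))) ⟩
    p c * (∑ (allFin a) (λ d → p d * sgn c d) + ∑ (allFin a) (λ d → indicator (d Fin.≟ c) * p d))
      -- The trailing factor `1ℝ` is inserted because `p c ^ 2` computes to `p c * (p c * 1ℝ)`.
      ≈⟨ *-congˡ (p c) (+-cong ≈-refl
           (≈-trans (∑-indicator {_≟_ = Fin._≟_} (allFin⁺ a) (∈-allFin c) p) (≈-sym (*-identityʳ (p c))))) ⟩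
    p c * (∑ (allFin a) (λ d → p d * sgn c d) + p c * 1ℝ)
      ≈⟨ distribˡ (p c) _ _ ⟩
    p c * ∑ (allFin a) (λ d → p d * sgn c d) + p c ^ 2
      ≈⟨ +-cong (∑-*ˡ (allFin a) (p c) (λ d → p d * sgn c d)) ≈-refl ⟨
    ∑ (allFin a) (λ d → p c * (p d * sgn c d)) + p c ^ 2  ∎

𝔼-biasedShuffle-1 : ∀ {n a} (p : Vector ℝ a) → sum p ≈ 1ℝ → 𝔼 (biasedShuffle n p) (λ _ → 1ℝ) ≈ 1ℝ
𝔼-biasedShuffle-1 {n} {a} p ∑p≈1 = begin
  𝔼 (biasedShuffle n p) (λ _ → 1ℝ)        ≈⟨ 𝔼-biasedShuffle {n} p (λ _ → 1ℝ) (λ _ → ≈-refl) ⟩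
  ∑ (words a n) (λ w → weight p w * 1ℝ)   ≈⟨ ∑-cong (words a n) (λ w → *-identityʳ (weight p w)) ⟩
  ∑ (words a n) (weight p)                ≈⟨ ∑-words-mass n p ∑p≈1 ⟩
  1ℝ                                      ∎

-- Stated for all `u` and `v`, since in a product the shuffle acts on images of a pair that can come
-- in either order. Standardization settles `u` below `v`; antisymmetry of `sgn` transfers this to
-- the reverse order.
𝔼-biasedShuffle-sgn : ∀ {n a} (p : Vector ℝ a) → sum p ≈ 1ℝ → ∀ u v →
  𝔼 (biasedShuffle n p) (λ π → sgn (π ⟨$⟩ʳ u) (π ⟨$⟩ʳ v)) ≈ sum (λ i → p i ^ 2) * sgn u v
𝔼-biasedShuffle-sgn {n} {a} p ∑p≈1 u v = by-order (Fin.<-cmp u v)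
  where
  P = biasedShuffle n p
  s = sum (λ i → p i ^ 2)

  increasing : ∀ {u v} → u Fin.< v → 𝔼 P (λ π → sgn (π ⟨$⟩ʳ u) (π ⟨$⟩ʳ v)) ≈ s
  increasing {u} {v} u<v = begin
    𝔼 P (λ π → sgn (π ⟨$⟩ʳ u) (π ⟨$⟩ʳ v))
      ≈⟨ 𝔼-biasedShuffle p (λ π → sgn (π ⟨$⟩ʳ u) (π ⟨$⟩ʳ v))
           (λ π≈σ → ≈-reflexive (cong₂ sgn (π≈σ u) (π≈σ v))) ⟩
    ∑ (words a n) (λ w → weight p w * sgn (standardization w ⟨$⟩ʳ u) (standardization w ⟨$⟩ʳ v))
      ≈⟨ ∑-cong (words a n) (λ w → *-congˡ (weight p w) (standardization-sgn w u<v)) ⟩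
    ∑ (words a n) (λ w → weight p w * (sgn (lookup w u) (lookup w v) + indicator (lookup w v Fin.≟ lookup w u)))
      ≈⟨ ∑-words-lookup₂ n p ∑p≈1 (λ c d → sgn c d + indicator (d Fin.≟ c)) u<v ⟩
    ∑ (allFin a) (λ c → p c * ∑ (allFin a) (λ d → p d * (sgn c d + indicator (d Fin.≟ c))))
      ≈⟨ ∑∑-standardization-sgn p ⟩
    s  ∎

  neg-factor : ∀ x y → x * (- y) ≈ (- 1ℝ) * (x * y)
  neg-factor x y = pointwise⇒≈ λ k →
    solve 2 (λ x y → x :* (:- y) := (:- con 1ℚ) :* (x :* y)) ≡.refl (seq x k) (seq y k)
    where open +-*-Solver

  by-order : ∀ {u v} → Tri (u Fin.< v) (u ≡ v) (v Fin.< u) →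
             𝔼 P (λ π → sgn (π ⟨$⟩ʳ u) (π ⟨$⟩ʳ v)) ≈ s * sgn u v
  by-order {u} {v} (tri< u<v _ _) = begin
    𝔼 P (λ π → sgn (π ⟨$⟩ʳ u) (π ⟨$⟩ʳ v))   ≈⟨ increasing u<v ⟩
    s                                        ≈⟨ *-identityʳ s ⟨
    s * 1ℝ                                   ≈⟨ *-congˡ s (sgn-< u<v) ⟨
    s * sgn u v                              ∎
  by-order {u} {v} (tri≈ _ u≡v _) = begin
    𝔼 P (λ π → sgn (π ⟨$⟩ʳ u) (π ⟨$⟩ʳ v))
      ≈⟨ ∑-cong (permutations n) (λ π → ≈-trans (*-congˡ (P π) (sgn-≡ (cong (π ⟨$⟩ʳ_) u≡v))) (zeroʳ (P π))) ⟩
    ∑ (permutations n) (λ _ → 0ℝ)            ≈⟨ ∑-zero (permutations n) ⟩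
    0ℝ                                       ≈⟨ zeroʳ s ⟨
    s * 0ℝ                                   ≈⟨ *-congˡ s (sgn-≡ u≡v) ⟨
    s * sgn u v                              ∎
  by-order {u} {v} (tri> _ _ v<u) = begin
    𝔼 P (λ π → sgn (π ⟨$⟩ʳ u) (π ⟨$⟩ʳ v))
      ≈⟨ ∑-cong (permutations n) (λ π → ≈-trans
           (*-congˡ (P π) (sgn-flip (π ⟨$⟩ʳ u) (π ⟨$⟩ʳ v)))
           (neg-factor (P π) (sgn (π ⟨$⟩ʳ v) (π ⟨$⟩ʳ u)))) ⟩
    ∑ (permutations n) (λ π → (- 1ℝ) * (P π * sgn (π ⟨$⟩ʳ v) (π ⟨$⟩ʳ u)))
      ≈⟨ ∑-*ˡ (permutations n) (- 1ℝ) (λ π → P π * sgn (π ⟨$⟩ʳ v) (π ⟨$⟩ʳ u)) ⟩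
    (- 1ℝ) * 𝔼 P (λ π → sgn (π ⟨$⟩ʳ v) (π ⟨$⟩ʳ u))
      ≈⟨ *-congˡ (- 1ℝ) (increasing v<u) ⟩
    (- 1ℝ) * s     ≈⟨ *-comm (- 1ℝ) s ⟩
    s * (- 1ℝ)     ≈⟨ *-congˡ s (sgn-> v<u) ⟨
    s * sgn u v    ∎

-- Convolution powers and eigenfunctions on pairs.

composite : ∀ {n k} → Vec (Permutation n n) k → Permutation n n
composite {n} = Vec.foldr (λ _ → Permutation n n) _·_ Perm.id

𝔼-convolutionPower : ∀ {n} k (P : Measure n) (f : Permutation n n → ℝ) → RespectsPerm f →
  𝔼 (convolutionPower k P) f
    ≈ ∑ (tuples (permutations n) k) (λ σs → product (λ i → P (lookup σs i)) * f (composite σs))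
𝔼-convolutionPower {n} k P f f-resp = begin
  ∑ (permutations n) (λ π → ∑ Σs (λ σs → indicator (π ≟ₚ composite σs) * W σs) * f π)
    ≈⟨ ∑-cong (permutations n) (λ π → ∑-*ʳ Σs (f π) (λ σs → indicator (π ≟ₚ composite σs) * W σs)) ⟨
  ∑ (permutations n) (λ π → ∑ Σs (λ σs → (indicator (π ≟ₚ composite σs) * W σs) * f π))
    ≈⟨ ∑-swap (permutations n) Σs (λ π σs → (indicator (π ≟ₚ composite σs) * W σs) * f π) ⟩
  ∑ Σs (λ σs → ∑ (permutations n) (λ π → (indicator (π ≟ₚ composite σs) * W σs) * f π))
    ≈⟨ ∑-cong Σs (λ σs → ∑-cong (permutations n) (λ π → ≈-trans
         (*-congʳ (f π) (*-comm (indicator (π ≟ₚ composite σs)) (W σs)))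
         (*-assoc (W σs) (indicator (π ≟ₚ composite σs)) (f π)))) ⟩
  ∑ Σs (λ σs → ∑ (permutations n) (λ π → W σs * (indicator (π ≟ₚ composite σs) * f π)))
    ≈⟨ ∑-cong Σs (λ σs → ∑-*ˡ (permutations n) (W σs) (λ π → indicator (π ≟ₚ composite σs) * f π)) ⟩
  ∑ Σs (λ σs → W σs * ∑ (permutations n) (λ π → indicator (π ≟ₚ composite σs) * f π))
    ≈⟨ ∑-cong Σs (λ σs → *-congˡ (W σs) (∑-permutations n (composite σs) f f-resp)) ⟩
  ∑ Σs (λ σs → W σs * f (composite σs))  ∎
  where
  Σs = tuples (permutations n) k
  W : Vec (Permutation n n) k → ℝ
  W σs = product (λ i → P (lookup σs i))

-- The first factor of the product acts last. With the other factors fixed, averaging over it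
-- applies the eigenvalue equation at the images of `u` and `v`, which pulls out one factor `s` and
-- leaves a product of one factor fewer.
𝔼-eigenfunction : ∀ {n} (P : Measure n) (g : Fin n → Fin n → ℝ) (s : ℝ) →
  (∀ u v → 𝔼 P (λ π → g (π ⟨$⟩ʳ u) (π ⟨$⟩ʳ v)) ≈ s * g u v) →
  ∀ k u v → 𝔼 (convolutionPower k P) (λ π → g (π ⟨$⟩ʳ u) (π ⟨$⟩ʳ v)) ≈ s ^ k * g u v
𝔼-eigenfunction {n} P g s eigen k u v = ≈-trans
  (𝔼-convolutionPower k P (λ π → g (π ⟨$⟩ʳ u) (π ⟨$⟩ʳ v)) (λ π≈σ → ≈-reflexive (cong₂ g (π≈σ u) (π≈σ v))))
  (iterate k)
  where
  W : ∀ {k} → Vec (Permutation n n) k → ℝ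
  W σs = product (λ i → P (lookup σs i))
  g∘ : Permutation n n → ℝ
  g∘ π = g (π ⟨$⟩ʳ u) (π ⟨$⟩ʳ v)
  iterate : ∀ k → ∑ (tuples (permutations n) k) (λ σs → W σs * g∘ (composite σs)) ≈ s ^ k * g u v
  iterate zero    = +-identityʳ (1ℝ * g u v)
  iterate (suc k) = begin
    ∑ (tuples (permutations n) (suc k)) (λ σs → W σs * g∘ (composite σs))
      ≈⟨ ∑-tuples (permutations n) k (λ σs → W σs * g∘ (composite σs)) ⟩
    ∑ (permutations n) (λ σ → ∑ Σs (λ σs → (P σ * W σs) * g∘ (σ · composite σs)))
      ≈⟨ ∑-swap (permutations n) Σs (λ σ σs → (P σ * W σs) * g∘ (σ · composite σs)) ⟩
    ∑ Σs (λ σs → ∑ (permutations n) (λ σ → (P σ * W σs) * g∘ (σ · composite σs)))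
      ≈⟨ ∑-cong Σs (λ σs → ≈-trans
           (∑-cong (permutations n) (λ σ → ≈-trans
             (*-congʳ (g∘ (σ · composite σs)) (*-comm (P σ) (W σs)))
             (*-assoc (W σs) (P σ) (g∘ (σ · composite σs)))))
           (∑-*ˡ (permutations n) (W σs) (λ σ → P σ * g∘ (σ · composite σs)))) ⟩
    ∑ Σs (λ σs → W σs * 𝔼 P (λ σ → g (σ ⟨$⟩ʳ (composite σs ⟨$⟩ʳ u)) (σ ⟨$⟩ʳ (composite σs ⟨$⟩ʳ v))))
      ≈⟨ ∑-cong Σs (λ σs → ≈-trans
           (*-congˡ (W σs) (eigen (composite σs ⟨$⟩ʳ u) (composite σs ⟨$⟩ʳ v)))
           (*-leftComm (W σs) s (g∘ (composite σs)))) ⟩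
    ∑ Σs (λ σs → s * (W σs * g∘ (composite σs)))
      ≈⟨ ∑-*ˡ Σs s (λ σs → W σs * g∘ (composite σs)) ⟩
    s * ∑ Σs (λ σs → W σs * g∘ (composite σs))   ≈⟨ *-congˡ s (iterate k) ⟩
    s * (s ^ k * g u v)                          ≈⟨ *-assoc s (s ^ k) (g u v) ⟨
    s ^ suc k * g u v                            ∎
    where Σs = tuples (permutations n) k

1^ : ∀ k → 1ℝ ^ k ≈ 1ℝ
1^ zero    = ≈-refl
1^ (suc k) = ≈-trans (*-identityˡ (1ℝ ^ k)) (1^ k)

-- Total mass is the case of the constant eigenfunction with eigenvalue 1; the point of `Fin n`
-- supplies the pair at which it is evaluated.
𝔼-convolutionPower-1 : ∀ {n} k (P : Measure n) → 𝔼 P (λ _ → 1ℝ) ≈ 1ℝ → Fin n →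
                       𝔼 (convolutionPower k P) (λ _ → 1ℝ) ≈ 1ℝ
𝔼-convolutionPower-1 k P mass≈1 x = ≈-trans
  (𝔼-eigenfunction P (λ _ _ → 1ℝ) 1ℝ (λ _ _ → ≈-trans mass≈1 (≈-sym (*-identityˡ 1ℝ))) k x x)
  (≈-trans (*-identityʳ (1ℝ ^ k)) (1^ k))

-- Inversions as a sum over pairs of positions.

positionPairs : ∀ n → List (Fin n × Fin n)
positionPairs n = List.cartesianProduct (allFin n) (allFin n)

𝟙< : ∀ {n} → Fin n × Fin n → ℝ
𝟙< (x , y) = indicator (x Fin.<? y)

-- Pascal's rule: the pairs with first entry `zero` number `n C 1`, and the remaining ones are the
-- pairs for `n` shifted by one.
∑-positionPairs : ∀ n → ∑ (positionPairs n) 𝟙< ≈ fromℕ (n C 2)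
∑-positionPairs n = ≈-trans (∑-cartesianProduct (allFin n) (allFin n) 𝟙<) (count n)
  where
  count : ∀ n → ∑ (allFin n) (λ x → ∑ (allFin n) (λ y → indicator (x Fin.<? y))) ≈ fromℕ (n C 2)
  count zero    = ≈-refl
  count (suc n) = begin
    ∑ (allFin (suc n)) (λ x → ∑ (allFin (suc n)) (λ y → indicator (x Fin.<? y)))
      ≈⟨ ∑-allFin n (λ x → ∑ (allFin (suc n)) (λ y → indicator (x Fin.<? y))) ⟩
    ∑ (allFin (suc n)) (λ y → indicator (zero {n} Fin.<? y))
      + ∑ (allFin n) (λ x → ∑ (allFin (suc n)) (λ y → indicator (suc x Fin.<? y)))
      ≈⟨ +-cong first (∑-cong (allFin n) rest) ⟩
    fromℕ (n C 1) + ∑ (allFin n) (λ x → ∑ (allFin n) (λ y → indicator (x Fin.<? y)))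
      ≈⟨ +-cong ≈-refl (count n) ⟩
    fromℕ (n C 1) + fromℕ (n C 2)
      ≈⟨ fromℕ-+ (n C 1) (n C 2) ⟨
    fromℕ (n C 1 ℕ.+ n C 2)
      ≡⟨ cong fromℕ (ℕ.nCk+nC[k+1]≡[n+1]C[k+1] n 1) ⟩
    fromℕ (suc n C 2)  ∎
    where
    first : ∑ (allFin (suc n)) (λ y → indicator (zero {n} Fin.<? y)) ≈ fromℕ (n C 1)
    first = begin
      ∑ (allFin (suc n)) (λ y → indicator (zero {n} Fin.<? y))
        ≈⟨ ∑-allFin n (λ y → indicator (zero {n} Fin.<? y)) ⟩
      0ℝ + ∑ (allFin n) (λ _ → 1ℝ)     ≈⟨ +-identityˡ _ ⟩
      ∑ (allFin n) (λ _ → 1ℝ)          ≈⟨ fromℕ-length (allFin n) ⟨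
      fromℕ (List.length (allFin n))   ≡⟨ cong fromℕ (≡.trans (List.length-tabulate id) (≡.sym (ℕ.nC1≡n n))) ⟩
      fromℕ (n C 1)                    ∎
    rest : ∀ x → ∑ (allFin (suc n)) (λ y → indicator (suc x Fin.<? y)) ≈ ∑ (allFin n) (λ y → indicator (x Fin.<? y))
    rest x = begin
      ∑ (allFin (suc n)) (λ y → indicator (suc x Fin.<? y))
        ≈⟨ ∑-allFin n (λ y → indicator (suc x Fin.<? y)) ⟩
      0ℝ + ∑ (allFin n) (λ y → indicator (suc x Fin.<? suc y))
        ≈⟨ +-identityˡ _ ⟩
      ∑ (allFin n) (λ y → indicator (suc x Fin.<? suc y))
        ≈⟨ ∑-cong (allFin n) (λ y → ≈-reflexive (indicator-⇔ (suc x Fin.<? suc y) (x Fin.<? y) ℕ.s≤s⁻¹ s≤s)) ⟩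
      ∑ (allFin n) (λ y → indicator (x Fin.<? y))  ∎

fromℕ-inversions : ∀ {n} (π : Permutation n n) →
  fromℕ (inversions π) ≈ fromℚ ½ * ∑ (positionPairs n) (λ xy →
    𝟙< xy * (1ℝ - sgn (π ⟨$⟩ʳ proj₁ xy) (π ⟨$⟩ʳ proj₂ xy)))
fromℕ-inversions {n} π = begin
  fromℕ (inversions π)
    ≈⟨ fromℕ-length-filter _ (positionPairs n) ⟩
  ∑ (positionPairs n) (λ (x , y) → indicator ((x Fin.<? y) ×-dec ((π ⟨$⟩ʳ y) Fin.<? (π ⟨$⟩ʳ x))))
    ≈⟨ ∑-cong (positionPairs n) (λ (x , y) → ≈-trans
         (indicator-× (x Fin.<? y) ((π ⟨$⟩ʳ y) Fin.<? (π ⟨$⟩ʳ x)))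
         (inverted (x Fin.<? y) (Fin.<-cmp (π ⟨$⟩ʳ x) (π ⟨$⟩ʳ y)))) ⟩
  ∑ (positionPairs n) (λ xy → fromℚ ½ * (𝟙< xy * (1ℝ - sgn (π ⟨$⟩ʳ proj₁ xy) (π ⟨$⟩ʳ proj₂ xy))))
    ≈⟨ ∑-*ˡ (positionPairs n) (fromℚ ½) (λ xy → 𝟙< xy * (1ℝ - sgn (π ⟨$⟩ʳ proj₁ xy) (π ⟨$⟩ʳ proj₂ xy))) ⟩
  fromℚ ½ * ∑ (positionPairs n) (λ xy → 𝟙< xy * (1ℝ - sgn (π ⟨$⟩ʳ proj₁ xy) (π ⟨$⟩ʳ proj₂ xy)))  ∎
  where
  inverted : ∀ {x y} (x<y? : Dec (x Fin.< y)) →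
    Tri (π ⟨$⟩ʳ x Fin.< π ⟨$⟩ʳ y) (π ⟨$⟩ʳ x ≡ π ⟨$⟩ʳ y) (π ⟨$⟩ʳ y Fin.< π ⟨$⟩ʳ x) →
    indicator x<y? * indicator ((π ⟨$⟩ʳ y) Fin.<? (π ⟨$⟩ʳ x))
      ≈ fromℚ ½ * (indicator x<y? * (1ℝ - sgn (π ⟨$⟩ʳ x) (π ⟨$⟩ʳ y)))
  inverted (no _) _ =
    ≈-trans (zeroˡ _) (≈-sym (≈-trans (*-congˡ (fromℚ ½) (zeroˡ _)) (zeroʳ (fromℚ ½))))
  inverted {x} {y} (yes x<y) (tri< πx<πy _ πy≮πx) = begin
    1ℝ * indicator ((π ⟨$⟩ʳ y) Fin.<? (π ⟨$⟩ʳ x))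
      ≡⟨ cong (1ℝ *_) (indicator-false ((π ⟨$⟩ʳ y) Fin.<? (π ⟨$⟩ʳ x)) πy≮πx) ⟩
    1ℝ * 0ℝ                          ≈⟨ pointwise⇒≈ (λ _ → ≡.refl) ⟩
    fromℚ ½ * (1ℝ * (1ℝ - 1ℝ))
      ≈⟨ *-congˡ (fromℚ ½) (*-congˡ 1ℝ (+-cong (≈-refl {1ℝ}) (-‿cong (sgn-< πx<πy)))) ⟨
    fromℚ ½ * (1ℝ * (1ℝ - sgn (π ⟨$⟩ʳ x) (π ⟨$⟩ʳ y)))  ∎
  inverted {x} {y} (yes x<y) (tri≈ _ πx≡πy _) = ⊥-elim (ℕ.<-irrefl (cong toℕ x≡y) x<y)
    where
    x≡y : x ≡ y
    x≡y = ≡.trans (≡.sym (Perm.inverseˡ π)) (≡.trans (cong (π ⟨$⟩ˡ_) πx≡πy) (Perm.inverseˡ π))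
  inverted {x} {y} (yes x<y) (tri> _ _ πy<πx) = begin
    1ℝ * indicator ((π ⟨$⟩ʳ y) Fin.<? (π ⟨$⟩ʳ x))
      ≡⟨ cong (1ℝ *_) (indicator-true ((π ⟨$⟩ʳ y) Fin.<? (π ⟨$⟩ʳ x)) πy<πx) ⟩
    1ℝ * 1ℝ                          ≈⟨ pointwise⇒≈ (λ _ → ≡.refl) ⟩
    fromℚ ½ * (1ℝ * (1ℝ - (- 1ℝ)))
      ≈⟨ *-congˡ (fromℚ ½) (*-congˡ 1ℝ (+-cong (≈-refl {1ℝ}) (-‿cong (sgn-> πy<πx)))) ⟨
    fromℚ ½ * (1ℝ * (1ℝ - sgn (π ⟨$⟩ʳ x) (π ⟨$⟩ʳ y)))  ∎

theorem6 : ∀ (n a k : ℕ) → n ≥ 1 → a ≥ 1 → k ≥ 1 →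
    (p : Vector ℝ a) → IsProbabilityVector p →
    expectation (convolutionPower k (biasedShuffle n p)) inversions
    ≈ fromℚ (+ (n C 2) / 2) * (1ℝ - sum (λ i → p i ^ 2) ^ k)
theorem6 n a k _ _ _ p (_ , ∑p≈1) = begin
  𝔼 Pᵏ (λ π → fromℕ (inversions π))
    ≈⟨ ∑-cong (permutations n) (λ π → ≈-trans
         (*-congˡ (Pᵏ π) (fromℕ-inversions π))
         (*-leftComm (Pᵏ π) ½ℝ (∑ (positionPairs n) (defect π)))) ⟩
  ∑ (permutations n) (λ π → ½ℝ * (Pᵏ π * ∑ (positionPairs n) (defect π)))
    ≈⟨ ∑-*ˡ (permutations n) ½ℝ (λ π → Pᵏ π * ∑ (positionPairs n) (defect π)) ⟩
  ½ℝ * ∑ (permutations n) (λ π → Pᵏ π * ∑ (positionPairs n) (defect π))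
    ≈⟨ *-congˡ ½ℝ (≈-trans
         (∑-cong (permutations n) (λ π → ≈-sym (∑-*ˡ (positionPairs n) (Pᵏ π) (defect π))))
         (∑-swap (permutations n) (positionPairs n) (λ π xy → Pᵏ π * defect π xy))) ⟩
  ½ℝ * ∑ (positionPairs n) (λ xy → ∑ (permutations n) (λ π → Pᵏ π * defect π xy))
    ≈⟨ *-congˡ ½ℝ (∑-cong (positionPairs n) (λ (x , y) → mean-defect x y)) ⟩
  ½ℝ * ∑ (positionPairs n) (λ xy → 𝟙< xy * (1ℝ - s ^ k))
    ≈⟨ *-congˡ ½ℝ (≈-trans (∑-*ʳ (positionPairs n) (1ℝ - s ^ k) 𝟙<)
         (*-congʳ (1ℝ - s ^ k) (∑-positionPairs n))) ⟩
  ½ℝ * (fromℕ (n C 2) * (1ℝ - s ^ k))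
    ≈⟨ *-assoc ½ℝ (fromℕ (n C 2)) (1ℝ - s ^ k) ⟨
  (½ℝ * fromℕ (n C 2)) * (1ℝ - s ^ k)
    ≈⟨ *-congʳ (1ℝ - s ^ k) (fromℚ-/2 (n C 2)) ⟨
  fromℚ (+ (n C 2) / 2) * (1ℝ - s ^ k)  ∎
  where
  P  = biasedShuffle n p
  Pᵏ = convolutionPower k P
  s  = sum (λ i → p i ^ 2)
  ½ℝ = fromℚ ½
  defect : Permutation n n → Fin n × Fin n → ℝ
  defect π (x , y) = 𝟙< (x , y) * (1ℝ - sgn (π ⟨$⟩ʳ x) (π ⟨$⟩ʳ y))

  -- The factor `1ℝ` is kept in `q * 1ℝ` so that the first half of the sum is literally
  -- `𝔼 Pᵏ (λ _ → 1ℝ)`.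
  expand : ∀ q i t → q * (i * (1ℝ - t)) ≈ i * (q * 1ℝ - q * t)
  expand q i t = pointwise⇒≈ λ l →
    solve 3 (λ q i t → q :* (i :* (con 1ℚ :- t)) := i :* (q :* con 1ℚ :- q :* t)) ≡.refl
      (seq q l) (seq i l) (seq t l)
    where open +-*-Solver

  -- The eigenvalue equation leaves a factor `sgn x y`; it is 1 wherever the indicator does not
  -- vanish.
  given-order : ∀ {x y} (x<y? : Dec (x Fin.< y)) →
                indicator x<y? * (1ℝ - s ^ k * sgn x y) ≈ indicator x<y? * (1ℝ - s ^ k)
  given-order (no _)    = ≈-trans (zeroˡ _) (≈-sym (zeroˡ _))
  given-order (yes x<y) = *-congˡ 1ℝ (+-cong (≈-refl {1ℝ}) (-‿cong
    (≈-trans (*-congˡ (s ^ k) (sgn-< x<y)) (*-identityʳ (s ^ k)))))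

  mean-defect : ∀ x y → ∑ (permutations n) (λ π → Pᵏ π * defect π (x , y)) ≈ 𝟙< (x , y) * (1ℝ - s ^ k)
  mean-defect x y = begin
    ∑ (permutations n) (λ π → Pᵏ π * defect π (x , y))
      ≈⟨ ∑-cong (permutations n) (λ π → expand (Pᵏ π) (𝟙< (x , y)) (ε π)) ⟩
    ∑ (permutations n) (λ π → 𝟙< (x , y) * (Pᵏ π * 1ℝ - Pᵏ π * ε π))
      ≈⟨ ∑-*ˡ (permutations n) (𝟙< (x , y)) (λ π → Pᵏ π * 1ℝ - Pᵏ π * ε π) ⟩
    𝟙< (x , y) * ∑ (permutations n) (λ π → Pᵏ π * 1ℝ - Pᵏ π * ε π)
      ≈⟨ *-congˡ (𝟙< (x , y)) (∑-- (permutations n) (λ π → Pᵏ π * 1ℝ) (λ π → Pᵏ π * ε π)) ⟩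
    𝟙< (x , y) * (𝔼 Pᵏ (λ _ → 1ℝ) - 𝔼 Pᵏ ε)
      ≈⟨ *-congˡ (𝟙< (x , y)) (+-cong
           (𝔼-convolutionPower-1 k P (𝔼-biasedShuffle-1 {n} p ∑p≈1) x)
           (-‿cong (𝔼-eigenfunction P sgn s (𝔼-biasedShuffle-sgn p ∑p≈1) k x y))) ⟩
    𝟙< (x , y) * (1ℝ - s ^ k * sgn x y)
      ≈⟨ given-order (x Fin.<? y) ⟩
    𝟙< (x , y) * (1ℝ - s ^ k)  ∎
    where
    ε : Permutation n n → ℝ
    ε π = sgn (π ⟨$⟩ʳ x) (π ⟨$⟩ʳ y)
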